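{- Let $A$ be a finite alphabet of colors and $C$ a sentence over $A$. Then $$H_C=\sum_J K_{J,C}\,\mathfrak{S}_J,$$ where the sum runs over sentences $J$ with $|J|=|C|$ and $K_{J,C}$ is the number of colored immaculate tableaux of shape $J$ and type $C$.
   Context: Words are finite sequences of colors, $\cdot$ is concatenation; a sentence is a finite sequence $I=(w_1,\dots,w_k)$ of nonempty words; $|I|$ is its number of letters, $\ell(I)=k$; $Q\preceq S$ means $S$ is obtained from $Q$ by concatenating adjacent words. Let $x_{a,i}$ ($a\in A$, $i\ge1$) be variables subject only to $x_{a,i}x_{b,j}=x_{b,j}x_{a,i}$ for $i\ne j$; $x_{w,i}=x_{c_1,i}\cdots x_{c_r,i}$. $M_I=\sum_{j_1<\dots<j_k}x_{w_1,j_1}\cdots x_{w_k,j_k}$, $M_\emptyset=1$; $QSym_A=\mathrm{span}\{M_I\}$ with power-series product. $NSym_A$ is the free associative algebra on $H_w$ ($w$ nonempty words), $H_I=H_{w_1}\cdots H_{w_k}$, paired with $QSym_A$ by $\langle H_I,M_J\rangle=\delta_{I,J}$. For $M\in QSym_A$, $M^{\perp_r}$ is the linear map on $NSym_A$ with $\langle M^{\perp_r}(H),G\rangle=\langle H,GM\rangle$ for all $G$. For a nonempty word $v$, $\mathbb{B}_v(f)=\sum_u\sum_{Q}(-1)^{\ell(Q)}H_{(v\cdot u)}\big(\sum_{S\succeq Q}M^{\perp_r}_S(f)\big)$, where $u$ runs over all words (the empty word contributing only $Q=\emptyset$ with $M^{\perp_r}_\emptyset=\mathrm{id}$), $Q=(q_1,\dots,q_i)$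 over sentences with $q_i\cdots q_1=u$, $S$ over coarsenings of $Q$. The colored immaculate function of $J=(v_1,\dots,v_h)$ is $\mathfrak{S}_J=\mathbb{B}_{v_1}\cdots\mathbb{B}_{v_h}(1)$. For $J=(w_1,\dots,w_k)$ the colored composition diagram has $k$ left-justified rows (row 1 on top), row $i$ with $|w_i|$ boxes colored in order by the letters of $w_i$. A colored immaculate tableau of shape $J$ fills its boxes with positive integers weakly increasing left to right in rows and strictly increasing top to bottom in the first column; its type is the weak sentence $(u_1,\dots,u_m)$ where $u_i$ is the word of colors of the boxes containing $i$, read from the lowest row to the highest row, left to right within rows. -}

module Defs where

open import Data.Nat using (ℕ; zero; suc; _+_; _≤ᵇ_; _<ᵇ_; _≡ᵇ_)
open import Data.Fin using (Fin) renaming (_≟_ to _≟F_)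
open import Data.Bool using (Bool; true; false; _∧_; if_then_else_)
open import Data.Product using (_×_; _,_)
open import Data.Maybe using (Maybe; just; nothing)
open import Data.List using (List; []; _∷_; _++_; map; concatMap; length; take; drop;
                             reverse; zip; foldr; upTo; applyUpTo; concat)
open import Data.List.NonEmpty using (List⁺; _∷_; toList; _⁺++_; _∷⁺_) renaming (length to length⁺)
open import Data.List.Properties using (≡-dec)
open import Data.Integer as ℤ using (ℤ; 0ℤ; 1ℤ; -_)
open import Relation.Nullary.Decidable using (⌊_⌋; does)

module _ (n : ℕ) where

  Col : Set
  Col = Fin n

  Word : Set
  Word = List Col

  NWord : Set
  NWord = List⁺ Col

  Sentence : Set
  Sentence = List NWord

  -- weak sentences (words may be empty); also used as monomials:
  -- (u_1,...,u_L) stands for x_{u_1,1} x_{u_2,2} ... x_{u_L,L}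
  WSent : Set
  WSent = List Word

sumℤ : List ℤ → ℤ
sumℤ = foldr ℤ._+_ 0ℤ

countB : {X : Set} → (X → Bool) → List X → ℕ
countB p []       = 0
countB p (x ∷ xs) = if p x then suc (countB p xs) else countB p xs

sign : ℕ → ℤ
sign zero    = 1ℤ
sign (suc k) = - sign k

module _ {n : ℕ} where

  wordEq : Word n → Word n → Bool
  wordEq u v = does (≡-dec _≟F_ u v)

  wsentEq : WSent n → WSent n → Bool
  wsentEq m m' = does (≡-dec (≡-dec _≟F_) m m')

  toW : Sentence n → WSent n
  toW = map toList

  sentEq : Sentence n → Sentence n → Bool
  sentEq I J = wsentEq (toW I) (toW J)

  size : Sentence n → ℕ
  size I = foldr (λ w k → length⁺ w + k) 0 I

  stripPrefix : Word n → Word n → Maybe (Word n)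
  stripPrefix []      u       = just u
  stripPrefix (a ∷ v) []      = nothing
  stripPrefix (a ∷ v) (b ∷ u) = if does (a ≟F b) then stripPrefix v u else nothing

wordsOfLength : (n : ℕ) → ℕ → List (Word n)
wordsOfLength n zero    = [] ∷ []
wordsOfLength n (suc d) =
  concatMap (λ a → map (a ∷_) (wordsOfLength n d)) (Data.List.allFin n)
  where import Data.List

module _ {n : ℕ} where

  comps⁺ : Col n → Word n → List (Sentence n)
  comps⁺ a []      = ((a ∷ []) ∷ []) ∷ []
  comps⁺ a (b ∷ w) = concatMap ext (comps⁺ b w)
    where
    ext : Sentence n → List (Sentence n)
    ext []      = []
    ext (p ∷ s) = ((a ∷ []) ∷ p ∷ s) ∷ ((a ∷⁺ p) ∷ s) ∷ []

  comps : Word n → List (Sentence n)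
  comps []      = [] ∷ []
  comps (a ∷ w) = comps⁺ a w

  coarsen⁺ : NWord n → Sentence n → List (Sentence n)
  coarsen⁺ q []       = (q ∷ []) ∷ []
  coarsen⁺ q (q' ∷ Q) = concatMap ext (coarsen⁺ q' Q)
    where
    ext : Sentence n → List (Sentence n)
    ext []      = []
    ext (p ∷ s) = (q ∷ p ∷ s) ∷ ((q ⁺++ toList p) ∷ s) ∷ []

  coarsen : Sentence n → List (Sentence n)
  coarsen []      = [] ∷ []
  coarsen (q ∷ Q) = coarsen⁺ q Q

sentencesOfSize : (n : ℕ) → ℕ → List (Sentence n)
sentencesOfSize n d = concatMap comps (wordsOfLength n d)

-- QSym_A : power series in the x_{a,i}, given by their coefficient at
-- every monomial (a weak sentence, see WSent).

PS : ℕ → Set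
PS n = WSent n → ℤ

module _ {n : ℕ} where

  dropEmpty : WSent n → Sentence n
  dropEmpty []            = []
  dropEmpty ([] ∷ m)      = dropEmpty m
  dropEmpty ((a ∷ u) ∷ m) = (a ∷ u) ∷ dropEmpty m

  M : Sentence n → PS n
  M I m = if sentEq (dropEmpty m) I then 1ℤ else 0ℤ

  wordSplits : Word n → List (Word n × Word n)
  wordSplits u = map (λ k → take k u , drop k u) (upTo (suc (length u)))

  -- all factorizations of a monomial  m = m₁ m₂
  -- (x_{u,i} = x_{p,i} x_{q,i} whenever u = p·q)
  factorizations : WSent n → List (WSent n × WSent n)
  factorizations []      = ([] , []) ∷ []
  factorizations (u ∷ m) =
    concatMap (λ { (p , q) → map (λ { (m₁ , m₂) → (p ∷ m₁ , q ∷ m₂) }) (factorizations m) })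
              (wordSplits u)

  _*ps_ : PS n → PS n → PS n
  (f *ps g) m = sumℤ (map (λ { (m₁ , m₂) → f m₁ ℤ.* g m₂ }) (factorizations m))

-- NSym_A : elements Σ c_I H_I given by their coefficient function I ↦ c_I

NSym : ℕ → Set
NSym n = Sentence n → ℤ

module _ {n : ℕ} where

  H : Sentence n → NSym n
  H C K = if sentEq K C then 1ℤ else 0ℤ

  one : NSym n
  one = H []

  -- pairing ⟨H_I , f⟩ for f ∈ QSym_A: the coefficient of M_I in f, which
  -- is the coefficient of f at the monomial x_{w_1,1} ⋯ x_{w_k,k}.
  pair : Sentence n → PS n → ℤ
  pair I f = f (toW I)

  -- M_S^{⊥_r}: ⟨M_S^⊥(H),G⟩ = ⟨H, G M_S⟩; testing with G = M_J gives
  -- the coefficient of H_J in M_S^⊥(f) as Σ_I f_I ⟨H_I , M_J M_S⟩.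
  -- (Only I with |I| = |J| + |S| can contribute, by homogeneity.)
  Mperp : Sentence n → NSym n → NSym n
  Mperp S f J =
    sumℤ (map (λ I → f I ℤ.* pair I (M J *ps M S)) (sentencesOfSize n (size J + size S)))

  -- the inner operator  Σ_Q (-1)^{ℓ(Q)} Σ_{S ⪰ Q} M_S^⊥  for a word u,
  -- where Q = (q_1,…,q_i) with q_i ⋯ q_1 = u (u empty: identity)
  inner : Word n → NSym n → NSym n
  inner []      f K = f K
  inner (a ∷ u) f K =
    sumℤ (map (λ Q → sign (length Q) ℤ.* sumℤ (map (λ S → Mperp S f K) (coarsen Q)))
              (map reverse (comps (a ∷ u))))

  -- the creation operator 𝔹_v : coefficient of H_K in
  -- Σ_u H_{(v·u)} · inner u f
  𝔹 : NWord n → NSym n → NSym n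
  𝔹 v f []       = 0ℤ
  𝔹 v f (w ∷ K') with stripPrefix (toList v) (toList w)
  ... | nothing = 0ℤ
  ... | just u  = inner u f K'

  𝔖 : Sentence n → NSym n
  𝔖 J = foldr 𝔹 one J

rowsOf : ℕ → ℕ → List (List ℕ)
rowsOf m zero    = [] ∷ []
rowsOf m (suc r) = concatMap (λ i → map (i ∷_) (rowsOf m r)) (applyUpTo suc m)

weaklyInc : List ℕ → Bool
weaklyInc []           = true
weaklyInc (x ∷ [])     = true
weaklyInc (x ∷ y ∷ xs) = (x ≤ᵇ y) ∧ weaklyInc (y ∷ xs)

strictlyInc : List ℕ → Bool
strictlyInc []           = true
strictlyInc (x ∷ [])     = true
strictlyInc (x ∷ y ∷ xs) = (x <ᵇ y) ∧ strictlyInc (y ∷ xs)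

firstEntries : List (List ℕ) → List ℕ
firstEntries []             = []
firstEntries ([] ∷ T)       = firstEntries T
firstEntries ((x ∷ r) ∷ T)  = x ∷ firstEntries T

module _ {n : ℕ} where

  fillings : Sentence n → ℕ → List (List (List ℕ))
  fillings []      m = [] ∷ []
  fillings (w ∷ J) m =
    concatMap (λ r → map (r ∷_) (fillings J m)) (rowsOf m (length⁺ w))

  isImmaculate : List (List ℕ) → Bool
  isImmaculate T = foldr (λ r b → weaklyInc r ∧ b) true T ∧ strictlyInc (firstEntries T)

  colorsWith : ℕ → Word n → List ℕ → Word n
  colorsWith i []      _       = []
  colorsWith i (c ∷ w) []      = []
  colorsWith i (c ∷ w) (x ∷ r) = if x ≡ᵇ i then c ∷ colorsWith i w r else colorsWith i w r

  -- (u_1,…,u_m): u_i = colors of boxes containing i, read from the lowest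
  -- row to the highest row, left to right within rows
  typeOf : Sentence n → List (List ℕ) → ℕ → WSent n
  typeOf J T m =
    map (λ i → concat (map (λ { (w , r) → colorsWith i w r }) (reverse (zip (toW J) T))))
        (applyUpTo suc m)

  -- K_{J,C}: number of colored immaculate tableaux of shape J and type C.
  -- A tableau of type C has entries exactly in {1,…,ℓ(C)}.
  Kostka : Sentence n → Sentence n → ℕ
  Kostka J C =
    countB (λ T → isImmaculate T ∧ wsentEq (typeOf J T (length C)) (toW C))
           (fillings J (length C))

{-# OPTIONS --safe #-}

-- Write e_u^⊥ for the operator Σ_Q (-1)^ℓ(Q) Σ_{S ⪰ Q} M_S^⊥ in 𝔹_v = Σ_u H_{v·u} e_u^⊥, and h_t = Σ_I M_I over
-- the compositions I of the word t. A sign-reversing involution gives Σ_{t = s·u} e_u^⊥ h_s^⊥ = 0 for every nonempty t,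
-- and therefore H_w f = Σ_t 𝔹_{w·t}(h_t^⊥ f). For f = H_(u_2,…,u_k) the right-hand side is a sum over the ways of
-- cutting a suffix r_i off each u_i, with t = r_2⋯r_k: exactly the ways of filling the first row of an immaculate
-- tableau of type (w,u_2,…,u_k), where r_i consists of the colors of the boxes containing i. The rows below have type
-- (u_2',…,u_k') with u_i = u_i'·r_i, and iterating the expansion produces one 𝔖_J for each tableau of shape J.
module Submission where

open import Defs
open import Data.Bool using (Bool; true; false; T; _∧_; if_then_else_)
open import Data.Bool.Properties using () renaming (_≟_ to _≟ᴮ_)
open import Data.Empty using (⊥-elim)
open import Data.Fin using (Fin) renaming (_≟_ to _≟F_)
open import Data.Integer using (ℤ; 0ℤ; 1ℤ; -_; _+_; _*_) renaming (+_ to pos)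
open import Data.Integer.Properties
open import Data.Integer.Tactic.RingSolver using (solve-∀)
open import Data.List using (List; []; _∷_; _++_; map; concatMap; concat; length; take; drop; reverse; upTo; applyUpTo;
                             foldr; tabulate; allFin; replicate; zip; zipWith)
open import Data.List.NonEmpty using (List⁺; _∷_; toList; _⁺++_) renaming (length to length⁺)
open import Data.List.Properties using (≡-dec; map-∘; map-cong; map-tabulate; map-applyUpTo; map-upTo; ++-assoc; ++-identityʳ;
                                        ∷-injective; unfold-reverse; length-++; length-map; length-reverse;
                                        length-replicate; length-applyUpTo)
open import Data.List.Relation.Unary.All as All using (All; []; _∷_)
open import Data.List.Relation.Unary.All.Properties using (concat⁺; map⁺; ++⁺; replicate⁺; applyUpTo⁺₁)
open import Data.Maybe using (nothing; just; maybe′)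
open import Data.Nat using (ℕ; zero; suc; _≤_; _<_; z≤n; s≤s; _<ᵇ_; _≤ᵇ_; _≡ᵇ_) renaming (_+_ to _ℕ+_; _≟_ to _≟ℕ_)
import Data.Nat.Properties as ℕₚ
open import Data.Nat.Tactic.RingSolver using () renaming (solve-∀ to ℕ-solve-∀)
open import Data.Product using (∃-syntax; _×_; _,_; proj₁; proj₂; uncurry)
open import Data.Unit using (tt)
open import Function using (_∘_)
open import Relation.Binary.Definitions using (DecidableEquality)
open import Relation.Binary.PropositionalEquality
open import Relation.Nullary using (Dec; yes; no; does; ¬_)
open import Relation.Nullary.Decidable using (_×-dec_)

open ≡-Reasoning

-- Elements of `NSym` and `PS` are bare coefficient functions, so operator identities become
-- identities of finite integer sums over cuts of words (`σ`), factorizations of monomials (`𝓕`) and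
-- Kronecker deltas. The involution is never built as a map. The coefficient of a sentence in e_u
-- factors over its words (`η-∷`), so the vanishing reduces to a statement about one word,
-- `ε-cancel`. The reversed order q_i⋯q_1 = u is what makes this work: h_s reads the words of H_m in
-- order, so the piece taken from the first word stands at the front of t, while e_u reads them
-- backwards, so its piece stands at the end. The middle of t concerns the other words only, and
-- induction applies to it. Cutting suffixes can empty a word, but the position of a word is the
-- entry it describes. Hence all inductions run over weak sentences, H_m is read as
-- `H (dropEmpty m)`, and the length of m bounds the recursion. Each expansion step puts the first
-- nonempty word wholly into the top row. On the tableau side this says that the smallest remaining
-- entry occurs in the top remaining row only, which is what strict increase of the first column
-- means when rows increase weakly.

private variable
  X Y : Set
  P Q : Set
  n : ℕ

-- Finite sums, indicators and splittings of lists

∑ : List X → (X → ℤ) → ℤ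
∑ xs f = sumℤ (map f xs)

∑-cong : {f g : X → ℤ} (xs : List X) → (∀ x → f x ≡ g x) → ∑ xs f ≡ ∑ xs g
∑-cong xs eq = cong sumℤ (map-cong eq xs)

∑-cong-All : {A : X → Set} {f g : X → ℤ} {xs : List X} →
  All A xs → (∀ x → A x → f x ≡ g x) → ∑ xs f ≡ ∑ xs g
∑-cong-All []       eq = refl
∑-cong-All (a ∷ as) eq = cong₂ _+_ (eq _ a) (∑-cong-All as eq)

∑-zero : (xs : List X) → ∑ xs (λ _ → 0ℤ) ≡ 0ℤ
∑-zero []       = refl
∑-zero (x ∷ xs) = trans (+-identityˡ _) (∑-zero xs)

∑-vanish : {f : X → ℤ} (xs : List X) → (∀ x → f x ≡ 0ℤ) → ∑ xs f ≡ 0ℤ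
∑-vanish xs eq = trans (∑-cong xs eq) (∑-zero xs)

interchange : ∀ a b c d → (a + b) + (c + d) ≡ (a + c) + (b + d)
interchange = solve-∀

∑-+ : (xs : List X) (f g : X → ℤ) → ∑ xs (λ x → f x + g x) ≡ ∑ xs f + ∑ xs g
∑-+ []       f g = refl
∑-+ (x ∷ xs) f g = trans (cong (f x + g x +_) (∑-+ xs f g)) (interchange (f x) (g x) (∑ xs f) (∑ xs g))

∑-*ˡ : (xs : List X) (c : ℤ) (f : X → ℤ) → ∑ xs (λ x → c * f x) ≡ c * ∑ xs f
∑-*ˡ []       c f = sym (*-zeroʳ c)
∑-*ˡ (x ∷ xs) c f = trans (cong (c * f x +_) (∑-*ˡ xs c f)) (sym (*-distribˡ-+ c (f x) (∑ xs f)))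

∑-*ʳ : (xs : List X) (f : X → ℤ) (c : ℤ) → ∑ xs (λ x → f x * c) ≡ ∑ xs f * c
∑-*ʳ xs f c = trans (∑-cong xs (λ x → *-comm (f x) c)) (trans (∑-*ˡ xs c f) (*-comm c _))

∑-swap : (xs : List X) (ys : List Y) (f : X → Y → ℤ) →
  ∑ xs (λ x → ∑ ys (f x)) ≡ ∑ ys (λ y → ∑ xs (λ x → f x y))
∑-swap []       ys f = sym (∑-zero ys)
∑-swap (x ∷ xs) ys f =
  trans (cong (∑ ys (f x) +_) (∑-swap xs ys f)) (sym (∑-+ ys (f x) (λ y → ∑ xs (λ x → f x y))))

∑-map : (h : X → Y) (xs : List X) (f : Y → ℤ) → ∑ (map h xs) f ≡ ∑ xs (f ∘ h)
∑-map h xs f = cong sumℤ (sym (map-∘ xs))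

∑-++ : (xs ys : List X) (f : X → ℤ) → ∑ (xs ++ ys) f ≡ ∑ xs f + ∑ ys f
∑-++ []       ys f = sym (+-identityˡ _)
∑-++ (x ∷ xs) ys f = trans (cong (f x +_) (∑-++ xs ys f)) (sym (+-assoc (f x) _ _))

∑-concatMap : (h : X → List Y) (xs : List X) (f : Y → ℤ) →
  ∑ (concatMap h xs) f ≡ ∑ xs (λ x → ∑ (h x) f)
∑-concatMap h []       f = refl
∑-concatMap h (x ∷ xs) f = trans (∑-++ (h x) (concatMap h xs) f) (cong (∑ (h x) f +_) (∑-concatMap h xs f))

ι : Bool → ℤ
ι b = if b then 1ℤ else 0ℤ

ι-∧ : ∀ b c → ι (b ∧ c) ≡ ι b * ι c
ι-∧ true  c = sym (*-identityˡ _)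
ι-∧ false c = refl

pos-countB : (p : X → Bool) (xs : List X) → pos (countB p xs) ≡ ∑ xs (ι ∘ p)
pos-countB p []       = refl
pos-countB p (x ∷ xs) with p x
... | true  = cong (1ℤ +_) (pos-countB p xs)
... | false = trans (pos-countB p xs) (sym (+-identityˡ _))

𝟙 : Dec P → ℤ
𝟙 d = ι (does d)

𝟙-yes : (d : Dec P) → P → 𝟙 d ≡ 1ℤ
𝟙-yes (yes _) p = refl
𝟙-yes (no ¬p) p = ⊥-elim (¬p p)

𝟙-no : (d : Dec P) → ¬ P → 𝟙 d ≡ 0ℤ
𝟙-no (yes p) ¬p = ⊥-elim (¬p p)
𝟙-no (no _)  ¬p = refl

𝟙-⇔ : (d : Dec P) (e : Dec Q) → (P → Q) → (Q → P) → 𝟙 d ≡ 𝟙 e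
𝟙-⇔ (yes p) e f g = sym (𝟙-yes e (f p))
𝟙-⇔ (no ¬p) e f g = sym (𝟙-no e (λ q → ¬p (g q)))

𝟙-*-cong : (d : Dec P) {x y : ℤ} → (P → x ≡ y) → 𝟙 d * x ≡ 𝟙 d * y
𝟙-*-cong (yes p) eq = cong (1ℤ *_) (eq p)
𝟙-*-cong (no ¬p) eq = refl

𝟙-× : {R : Set} (d : Dec P) (e : Dec Q) (r : Dec R) →
  (P → Q → R) → (R → P × Q) → 𝟙 d * 𝟙 e ≡ 𝟙 r
𝟙-× (yes p) e r f g = trans (*-identityˡ _) (𝟙-⇔ e r (f p) (proj₂ ∘ g))
𝟙-× (no ¬p) e r f g = sym (𝟙-no r (¬p ∘ proj₁ ∘ g))

-- The terms of the deconcatenation coproduct, empty halves included. It serves for words, cut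
-- between letters, and for sentences, cut between words.
splits : List X → List (List X × List X)
splits []       = ([] , []) ∷ []
splits (a ∷ u) = ([] , a ∷ u) ∷ map (λ (p , q) → (a ∷ p , q)) (splits u)

σ : List X → (List X → List X → ℤ) → ℤ
σ u G = ∑ (splits u) (uncurry G)

σ-[] : (G : List X → List X → ℤ) → σ [] G ≡ G [] []
σ-[] G = +-identityʳ _

σ-∷ : (a : X) (u : List X) (G : List X → List X → ℤ) →
  σ (a ∷ u) G ≡ G [] (a ∷ u) + σ u (λ p q → G (a ∷ p) q)
σ-∷ a u G = cong (G [] (a ∷ u) +_) (∑-map _ (splits u) (uncurry G))

σ-cong : {G G′ : List X → List X → ℤ} (u : List X) → (∀ p q → G p q ≡ G′ p q) → σ u G ≡ σ u G′
σ-cong u eq = ∑-cong (splits u) (uncurry eq)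

splits-++ : (u : List X) → All (λ (p , q) → p ++ q ≡ u) (splits u)
splits-++ []       = refl ∷ []
splits-++ (a ∷ u) = refl ∷ prepend (splits-++ u)
  where
  prepend : ∀ {pqs} → All (λ (p , q) → p ++ q ≡ u) pqs →
    All (λ (p , q) → p ++ q ≡ a ∷ u) (map (λ (p , q) → (a ∷ p , q)) pqs)
  prepend []         = []
  prepend (eq ∷ eqs) = cong (a ∷_) eq ∷ prepend eqs

σ-vanish : {G : List X → List X → ℤ} (u : List X) → (∀ p q → G p q ≡ 0ℤ) → σ u G ≡ 0ℤ
σ-vanish u eq = ∑-vanish (splits u) (uncurry eq)

σ-+ : (u : List X) (F G : List X → List X → ℤ) →
  σ u (λ p q → F p q + G p q) ≡ σ u F + σ u G
σ-+ u F G = ∑-+ (splits u) (uncurry F) (uncurry G)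

σ-*ˡ : (u : List X) (c : ℤ) (G : List X → List X → ℤ) → σ u (λ p q → c * G p q) ≡ c * σ u G
σ-*ˡ u c G = ∑-*ˡ (splits u) c (uncurry G)

σ-*ʳ : (u : List X) (G : List X → List X → ℤ) (c : ℤ) → σ u (λ p q → G p q * c) ≡ σ u G * c
σ-*ʳ u G c = ∑-*ʳ (splits u) (uncurry G) c

σ-swap : (u : List X) (ys : List Y) (G : List X → List X → Y → ℤ) →
  σ u (λ p q → ∑ ys (G p q)) ≡ ∑ ys (λ y → σ u (λ p q → G p q y))
σ-swap u ys G = ∑-swap (splits u) ys (uncurry G)

-- Coassociativity of deconcatenation: both sides run over the cuts into three parts `r`, `s`, `q`.
σ-assoc : (u : List X) (G : List X → List X → List X → ℤ) →
  σ u (λ t q → σ t (λ r s → G r s q)) ≡ σ u (λ r t → σ t (λ s q → G r s q))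
σ-assoc []       G = begin
  σ [] (λ t q → σ t (λ r s → G r s q))  ≡⟨ σ-[] (λ t q → σ t (λ r s → G r s q)) ⟩
  σ [] (λ r s → G r s [])               ≡⟨ σ-[] (λ r s → G r s []) ⟩
  G [] [] []                            ≡⟨ σ-[] (λ s q → G [] s q) ⟨
  σ [] (λ s q → G [] s q)               ≡⟨ σ-[] (λ r t → σ t (λ s q → G r s q)) ⟨
  σ [] (λ r t → σ t (λ s q → G r s q))  ∎
σ-assoc (a ∷ u) G = begin
  σ (a ∷ u) (λ t q → σ t (λ r s → G r s q))
    ≡⟨ σ-∷ a u (λ t q → σ t (λ r s → G r s q)) ⟩
  σ [] (λ r s → G r s (a ∷ u)) + σ u (λ t q → σ (a ∷ t) (λ r s → G r s q))
    ≡⟨ cong₂ _+_ (σ-[] (λ r s → G r s (a ∷ u))) (trans (σ-cong u (λ t q → σ-∷ a t (λ r s → G r s q)))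
         (σ-+ u (λ t q → G [] (a ∷ t) q) (λ t q → σ t (λ r s → G (a ∷ r) s q)))) ⟩
  G [] [] (a ∷ u) + (σ u (λ t q → G [] (a ∷ t) q) + σ u (λ t q → σ t (λ r s → G (a ∷ r) s q)))
    ≡⟨ +-assoc (G [] [] (a ∷ u)) _ _ ⟨
  (G [] [] (a ∷ u) + σ u (λ t q → G [] (a ∷ t) q)) + σ u (λ t q → σ t (λ r s → G (a ∷ r) s q))
    ≡⟨ cong₂ _+_ (sym (σ-∷ a u (λ s q → G [] s q))) (σ-assoc u (λ r s q → G (a ∷ r) s q)) ⟩
  σ (a ∷ u) (λ s q → G [] s q) + σ u (λ r t → σ t (λ s q → G (a ∷ r) s q))
    ≡⟨ σ-∷ a u (λ r t → σ t (λ s q → G r s q)) ⟨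
  σ (a ∷ u) (λ r t → σ t (λ s q → G r s q))  ∎

-- The counit of deconcatenation; `σ-𝟘ˡ` and `σ-𝟘ʳ` are its two laws.
𝟘 : List X → ℤ
𝟘 []      = 1ℤ
𝟘 (_ ∷ _) = 0ℤ

σ-𝟘ˡ : (u : List X) (G : List X → ℤ) → σ u (λ p q → 𝟘 p * G q) ≡ G u
σ-𝟘ˡ []       G = trans (σ-[] (λ p q → 𝟘 p * G q)) (*-identityˡ _)
σ-𝟘ˡ (a ∷ u) G = begin
  σ (a ∷ u) (λ p q → 𝟘 p * G q)          ≡⟨ σ-∷ a u (λ p q → 𝟘 p * G q) ⟩
  1ℤ * G (a ∷ u) + σ u (λ p q → 0ℤ)      ≡⟨ cong₂ _+_ (*-identityˡ (G (a ∷ u))) (σ-vanish u (λ _ _ → refl)) ⟩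
  G (a ∷ u) + 0ℤ                         ≡⟨ +-identityʳ _ ⟩
  G (a ∷ u)                              ∎

σ-𝟘ʳ : (u : List X) (G : List X → ℤ) → σ u (λ p q → G p * 𝟘 q) ≡ G u
σ-𝟘ʳ []       G = trans (σ-[] (λ p q → G p * 𝟘 q)) (*-identityʳ _)
σ-𝟘ʳ (a ∷ u) G = begin
  σ (a ∷ u) (λ p q → G p * 𝟘 q)                     ≡⟨ σ-∷ a u (λ p q → G p * 𝟘 q) ⟩
  G [] * 0ℤ + σ u (λ p q → G (a ∷ p) * 𝟘 q)         ≡⟨ cong₂ _+_ (*-zeroʳ (G [])) (σ-𝟘ʳ u (G ∘ (a ∷_))) ⟩
  0ℤ + G (a ∷ u)                                    ≡⟨ +-identityˡ _ ⟩
  G (a ∷ u)                                         ∎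

module Delta (_≟_ : DecidableEquality X) where

  _≟ᴸ_ : DecidableEquality (List X)
  _≟ᴸ_ = ≡-dec _≟_

  δ : List X → List X → ℤ
  δ x y = 𝟙 (x ≟ᴸ y)

  δ-∷ : ∀ a x b y → δ (a ∷ x) (b ∷ y) ≡ 𝟙 (a ≟ b) * δ x y
  δ-∷ a x b y = sym (𝟙-× (a ≟ b) (x ≟ᴸ y) ((a ∷ x) ≟ᴸ (b ∷ y)) (cong₂ _∷_) ∷-injective)

  δ-sym : ∀ x y → δ x y ≡ δ y x
  δ-sym x y = 𝟙-⇔ (x ≟ᴸ y) (y ≟ᴸ x) sym sym

  -- Only the cut of `u` after `length x` letters can contribute. Equations between words are broken
  -- up below in this way.
  δ-++ : (u x y : List X) → σ u (λ p q → δ p x * δ q y) ≡ δ u (x ++ y)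
  δ-++ []      []       y = trans (σ-[] (λ p q → δ p [] * δ q y)) (*-identityˡ _)
  δ-++ []      (b ∷ x)  y = refl
  δ-++ (a ∷ u) []       y = begin
    σ (a ∷ u) (λ p q → δ p [] * δ q y)                           ≡⟨ σ-∷ a u (λ p q → δ p [] * δ q y) ⟩
    1ℤ * δ (a ∷ u) y + σ u (λ p q → 0ℤ)  ≡⟨ cong₂ _+_ (*-identityˡ (δ (a ∷ u) y)) (σ-vanish u (λ _ _ → refl)) ⟩
    δ (a ∷ u) y + 0ℤ                     ≡⟨ +-identityʳ _ ⟩
    δ (a ∷ u) y                          ∎
  δ-++ (a ∷ u) (b ∷ x)  y = begin
    σ (a ∷ u) (λ p q → δ p (b ∷ x) * δ q y)              ≡⟨ σ-∷ a u (λ p q → δ p (b ∷ x) * δ q y) ⟩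
    0ℤ + σ u (λ p q → δ (a ∷ p) (b ∷ x) * δ q y)         ≡⟨ +-identityˡ _ ⟩
    σ u (λ p q → δ (a ∷ p) (b ∷ x) * δ q y)              ≡⟨ σ-cong u (λ p q → trans (cong (_* δ q y) (δ-∷ a p b x))
                                                              (*-assoc (𝟙 (a ≟ b)) _ _)) ⟩
    σ u (λ p q → 𝟙 (a ≟ b) * (δ p x * δ q y))            ≡⟨ σ-*ˡ u (𝟙 (a ≟ b)) (λ p q → δ p x * δ q y) ⟩
    𝟙 (a ≟ b) * σ u (λ p q → δ p x * δ q y)              ≡⟨ cong (𝟙 (a ≟ b) *_) (δ-++ u x y) ⟩
    𝟙 (a ≟ b) * δ u (x ++ y)                             ≡⟨ δ-∷ a u b (x ++ y) ⟨
    δ (a ∷ u) (b ∷ x ++ y)                               ∎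

-- The coefficients of Σ_Q (-1)^ℓ(Q) Σ_{S ⪰ Q} M_S

σ-cong-++ : {G G′ : List X → List X → ℤ} (u : List X) →
  (∀ p q → p ++ q ≡ u → G p q ≡ G′ p q) → σ u G ≡ σ u G′
σ-cong-++ u eq = ∑-cong-All (splits-++ u) (uncurry eq)

σ-∷ʳ : (u : List X) (a : X) (G : List X → List X → ℤ) →
  σ (u ++ a ∷ []) G ≡ σ u (λ p q → G p (q ++ a ∷ [])) + G (u ++ a ∷ []) []
σ-∷ʳ []      a G = begin
  σ (a ∷ []) G                        ≡⟨ σ-∷ a [] G ⟩
  G [] (a ∷ []) + σ [] (λ p q → G (a ∷ p) q)  ≡⟨ cong₂ _+_ (sym (σ-[] (λ p q → G p (q ++ a ∷ [])))) (σ-[] (λ p q → G (a ∷ p) q)) ⟩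
  σ [] (λ p q → G p (q ++ a ∷ [])) + G (a ∷ []) []  ∎
σ-∷ʳ (b ∷ u) a G = begin
  σ (b ∷ u ++ a ∷ []) G
    ≡⟨ σ-∷ b (u ++ a ∷ []) G ⟩
  G [] (b ∷ u ++ a ∷ []) + σ (u ++ a ∷ []) (λ p q → G (b ∷ p) q)
    ≡⟨ cong (G [] (b ∷ u ++ a ∷ []) +_) (σ-∷ʳ u a (λ p q → G (b ∷ p) q)) ⟩
  G [] (b ∷ u ++ a ∷ []) + (σ u (λ p q → G (b ∷ p) (q ++ a ∷ [])) + G (b ∷ u ++ a ∷ []) [])
    ≡⟨ +-assoc (G [] (b ∷ u ++ a ∷ [])) _ _ ⟨
  G [] (b ∷ u ++ a ∷ []) + σ u (λ p q → G (b ∷ p) (q ++ a ∷ [])) + G (b ∷ u ++ a ∷ []) []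
    ≡⟨ cong (_+ G (b ∷ u ++ a ∷ []) []) (σ-∷ b u (λ p q → G p (q ++ a ∷ []))) ⟨
  σ (b ∷ u) (λ p q → G p (q ++ a ∷ [])) + G (b ∷ u ++ a ∷ []) []  ∎

-- Reversal exchanges the two halves of a cut. This is needed because the sentences Q in the
-- definition of `inner` are reversed compositions of the word.
σ-reverse : (u : List X) (G : List X → List X → ℤ) →
  σ (reverse u) G ≡ σ u (λ p q → G (reverse q) (reverse p))
σ-reverse []      G = refl
σ-reverse (a ∷ u) G = begin
  σ (reverse (a ∷ u)) G
    ≡⟨ cong (λ v → σ v G) (unfold-reverse a u) ⟩
  σ (reverse u ++ a ∷ []) G
    ≡⟨ σ-∷ʳ (reverse u) a G ⟩
  σ (reverse u) (λ p q → G p (q ++ a ∷ [])) + G (reverse u ++ a ∷ []) []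
    ≡⟨ cong₂ _+_ (σ-reverse u (λ p q → G p (q ++ a ∷ []))) (cong (λ v → G v []) (sym (unfold-reverse a u))) ⟩
  σ u (λ p q → G (reverse q) (reverse p ++ a ∷ [])) + G (reverse (a ∷ u)) []
    ≡⟨ +-comm _ (G (reverse (a ∷ u)) []) ⟩
  G (reverse (a ∷ u)) [] + σ u (λ p q → G (reverse q) (reverse p ++ a ∷ []))
    ≡⟨ cong (G (reverse (a ∷ u)) [] +_) (σ-cong u (λ p q → cong (G (reverse q)) (unfold-reverse a p))) ⟨
  G (reverse (a ∷ u)) [] + σ u (λ p q → G (reverse q) (reverse (a ∷ p)))
    ≡⟨ σ-∷ a u (λ p q → G (reverse q) (reverse p)) ⟨
  σ (a ∷ u) (λ p q → G (reverse q) (reverse p))  ∎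

module _ {n : ℕ} where
  open Delta (_≟F_ {n}) public using () renaming (_≟ᴸ_ to _≟ᵂ_; δ to δᵂ; δ-++ to δᵂ-++; δ-sym to δᵂ-sym)
  open Delta _≟ᵂ_ public using () renaming (_≟ᴸ_ to _≟ˢ_; δ to δᵂˢ; δ-∷ to δᵂˢ-∷; δ-sym to δᵂˢ-sym)

δˢ : Sentence n → Sentence n → ℤ
δˢ I J = δᵂˢ (toW I) (toW J)

flat : Sentence n → Word n
flat Q = concat (toW Q)

flat-++ : (Q R : Sentence n) → flat (Q ++ R) ≡ flat Q ++ flat R
flat-++ []      R = refl
flat-++ (q ∷ Q) R = trans (cong (toList q ++_) (flat-++ Q R)) (sym (++-assoc (toList q) (flat Q) (flat R)))

flat-reverse-∷ : (q : NWord n) (Q : Sentence n) → flat (reverse (q ∷ Q)) ≡ flat (reverse Q) ++ toList q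
flat-reverse-∷ q Q = begin
  flat (reverse (q ∷ Q))           ≡⟨ cong flat (unfold-reverse q Q) ⟩
  flat (reverse Q ++ q ∷ [])       ≡⟨ flat-++ (reverse Q) (q ∷ []) ⟩
  flat (reverse Q) ++ toList q ++ []  ≡⟨ cong (flat (reverse Q) ++_) (++-identityʳ (toList q)) ⟩
  flat (reverse Q) ++ toList q     ∎

-- `comps⁺` decides at each letter whether a new word starts; here the whole first word `a ∷ x` is
-- chosen at once.
comps-first : (a : Col n) (w : Word n) (F : Sentence n → ℤ) →
  ∑ (comps (a ∷ w)) F ≡ σ w (λ x y → ∑ (comps y) (λ Q → F ((a ∷ x) ∷ Q)))
comps-first a []      F = sym (σ-[] (λ x y → ∑ (comps y) (λ Q → F ((a ∷ x) ∷ Q))))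
comps-first a (b ∷ w) F = begin
  ∑ (comps (a ∷ b ∷ w)) F
    ≡⟨ trans (∑-concatMap _ (comps⁺ b w) F) (comps-first b w _) ⟩
  σ w (λ x y → ∑ (comps y) (λ Q → F ((a ∷ []) ∷ (b ∷ x) ∷ Q) + (F ((a ∷ b ∷ x) ∷ Q) + 0ℤ)))
    ≡⟨ σ-cong w (λ x y → trans
         (∑-cong (comps y) (λ Q → cong (F ((a ∷ []) ∷ (b ∷ x) ∷ Q) +_) (+-identityʳ (F ((a ∷ b ∷ x) ∷ Q)))))
         (∑-+ (comps y) (λ Q → F ((a ∷ []) ∷ (b ∷ x) ∷ Q)) (λ Q → F ((a ∷ b ∷ x) ∷ Q)))) ⟩
  σ w (λ x y → ∑ (comps y) (λ Q → F ((a ∷ []) ∷ (b ∷ x) ∷ Q)) + ∑ (comps y) (λ Q → F ((a ∷ b ∷ x) ∷ Q)))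
    ≡⟨ σ-+ w (λ x y → ∑ (comps y) (λ Q → F ((a ∷ []) ∷ (b ∷ x) ∷ Q))) (λ x y → ∑ (comps y) (λ Q → F ((a ∷ b ∷ x) ∷ Q))) ⟩
  σ w (λ x y → ∑ (comps y) (λ Q → F ((a ∷ []) ∷ (b ∷ x) ∷ Q))) + σ w (λ x y → ∑ (comps y) (λ Q → F ((a ∷ b ∷ x) ∷ Q)))
    ≡⟨ cong (_+ σ w (λ x y → ∑ (comps y) (λ Q → F ((a ∷ b ∷ x) ∷ Q)))) (comps-first b w (λ Q → F ((a ∷ []) ∷ Q))) ⟨
  ∑ (comps (b ∷ w)) (λ Q → F ((a ∷ []) ∷ Q)) + σ w (λ x y → ∑ (comps y) (λ Q → F ((a ∷ b ∷ x) ∷ Q)))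
    ≡⟨ σ-∷ b w (λ x y → ∑ (comps y) (λ Q → F ((a ∷ x) ∷ Q))) ⟨
  σ (b ∷ w) (λ x y → ∑ (comps y) (λ Q → F ((a ∷ x) ∷ Q)))  ∎

-- The first word of a coarsening joins `q` to an initial block `R` of `Q`, possibly empty; the rest
-- `Q′` is coarsened independently.
coarsen-first : (q : NWord n) (Q : Sentence n) (F : Sentence n → ℤ) →
  ∑ (coarsen (q ∷ Q)) F ≡ σ Q (λ R Q′ → ∑ (coarsen Q′) (λ S → F ((q ⁺++ flat R) ∷ S)))
coarsen-first q [] F = begin
  F (q ∷ []) + 0ℤ            ≡⟨ cong (λ w → F ((List⁺.head q ∷ w) ∷ []) + 0ℤ) (++-identityʳ (List⁺.tail q)) ⟨
  F ((q ⁺++ []) ∷ []) + 0ℤ   ≡⟨ σ-[] (λ R Q′ → ∑ (coarsen Q′) (λ S → F ((q ⁺++ flat R) ∷ S))) ⟨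
  σ [] (λ R Q′ → ∑ (coarsen Q′) (λ S → F ((q ⁺++ flat R) ∷ S)))  ∎
coarsen-first q (q′ ∷ Q) F = begin
  ∑ (coarsen (q ∷ q′ ∷ Q)) F
    ≡⟨ trans (∑-concatMap _ (coarsen⁺ q′ Q) F) (coarsen-first q′ Q _) ⟩
  σ Q (λ R Q′ → ∑ (coarsen Q′) (λ S → A R S + (B R S + 0ℤ)))
    ≡⟨ σ-cong Q (λ R Q′ → trans
         (∑-cong (coarsen Q′) (λ S → cong (A R S +_) (+-identityʳ (B R S))))
         (∑-+ (coarsen Q′) (A R) (B R))) ⟩
  σ Q (λ R Q′ → ∑ (coarsen Q′) (A R) + ∑ (coarsen Q′) (B R))
    ≡⟨ σ-+ Q (λ R Q′ → ∑ (coarsen Q′) (A R)) (λ R Q′ → ∑ (coarsen Q′) (B R)) ⟩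
  σ Q (λ R Q′ → ∑ (coarsen Q′) (A R)) + σ Q (λ R Q′ → ∑ (coarsen Q′) (B R))
    ≡⟨ cong (_+ σ Q (λ R Q′ → ∑ (coarsen Q′) (B R))) (coarsen-first q′ Q (λ S → F (q ∷ S))) ⟨
  ∑ (coarsen (q′ ∷ Q)) (λ S → F (q ∷ S)) + σ Q (λ R Q′ → ∑ (coarsen Q′) (B R))
    ≡⟨ cong (λ w → ∑ (coarsen (q′ ∷ Q)) (λ S → F ((List⁺.head q ∷ w) ∷ S)) + σ Q (λ R Q′ → ∑ (coarsen Q′) (B R)))
         (++-identityʳ (List⁺.tail q)) ⟨
  ∑ (coarsen (q′ ∷ Q)) (λ S → F ((q ⁺++ []) ∷ S)) + σ Q (λ R Q′ → ∑ (coarsen Q′) (B R))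
    ≡⟨ σ-∷ q′ Q (λ R Q′ → ∑ (coarsen Q′) (λ S → F ((q ⁺++ flat R) ∷ S))) ⟨
  σ (q′ ∷ Q) (λ R Q′ → ∑ (coarsen Q′) (λ S → F ((q ⁺++ flat R) ∷ S)))  ∎
  where
  A B : Sentence _ → Sentence _ → ℤ
  A R S = F (q ∷ (q′ ⁺++ flat R) ∷ S)
  B R S = F ((q ⁺++ (toList q′ ++ flat R)) ∷ S)

-- A cut between two words of a composition is a cut of `u` together with a composition of each
-- half. The induction needs a bound on the length because `comps-first` leaves an arbitrary suffix
-- `y`.
comps-splits : (u : Word n) (G : Sentence n → Sentence n → ℤ) →
  ∑ (comps u) (λ Q → σ Q G) ≡ σ u (λ u₁ u₂ → ∑ (comps u₁) (λ Q₁ → ∑ (comps u₂) (G Q₁)))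
comps-splits {n} u G = go (length u) u ℕₚ.≤-refl G
  where
  go : ∀ k (u : Word n) → length u ≤ k → (G : Sentence n → Sentence n → ℤ) →
    ∑ (comps u) (λ Q → σ Q G) ≡ σ u (λ u₁ u₂ → ∑ (comps u₁) (λ Q₁ → ∑ (comps u₂) (G Q₁)))
  go k [] _ G = begin
    σ [] G + 0ℤ                                  ≡⟨ cong (_+ 0ℤ) (σ-[] G) ⟩
    G [] [] + 0ℤ                                 ≡⟨ cong (_+ 0ℤ) (+-identityʳ (G [] [])) ⟨
    ∑ (comps []) (λ Q₁ → ∑ (comps []) (G Q₁))    ≡⟨ σ-[] (λ u₁ u₂ → ∑ (comps u₁) (λ Q₁ → ∑ (comps u₂) (G Q₁))) ⟨
    σ [] (λ u₁ u₂ → ∑ (comps u₁) (λ Q₁ → ∑ (comps u₂) (G Q₁)))  ∎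
  go (suc k) (a ∷ w) (s≤s le) G = begin
    ∑ (comps (a ∷ w)) (λ Q → σ Q G)
      ≡⟨ comps-first a w (λ Q → σ Q G) ⟩
    σ w (λ x y → ∑ (comps y) (λ Q → σ ((a ∷ x) ∷ Q) G))
      ≡⟨ σ-cong w (λ x y → trans (∑-cong (comps y) (λ Q → σ-∷ (a ∷ x) Q G))
           (∑-+ (comps y) (λ Q → G [] ((a ∷ x) ∷ Q)) (λ Q → σ Q (λ Q₁ → G ((a ∷ x) ∷ Q₁))))) ⟩
    σ w (λ x y → ∑ (comps y) (λ Q → G [] ((a ∷ x) ∷ Q)) + ∑ (comps y) (λ Q → σ Q (λ Q₁ → G ((a ∷ x) ∷ Q₁))))
      ≡⟨ σ-+ w (λ x y → ∑ (comps y) (λ Q → G [] ((a ∷ x) ∷ Q))) (λ x y → ∑ (comps y) (λ Q → σ Q (λ Q₁ → G ((a ∷ x) ∷ Q₁)))) ⟩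
    σ w (λ x y → ∑ (comps y) (λ Q → G [] ((a ∷ x) ∷ Q))) + σ w (λ x y → ∑ (comps y) (λ Q → σ Q (λ Q₁ → G ((a ∷ x) ∷ Q₁))))
      ≡⟨ cong₂ _+_ (sym (comps-first a w (G []))) (σ-cong-++ w (λ x y eq →
           go k y (ℕₚ.≤-trans (suffix-≤ x y eq) le) (λ Q₁ → G ((a ∷ x) ∷ Q₁)))) ⟩
    ∑ (comps (a ∷ w)) (G []) + σ w (λ x y → σ y (λ y₁ y₂ → ∑ (comps y₁) (λ Q₁ → ∑ (comps y₂) (G ((a ∷ x) ∷ Q₁)))))
      ≡⟨ cong₂ _+_ (sym (+-identityʳ (∑ (comps (a ∷ w)) (G []))))
           (sym (σ-assoc w (λ x y₁ y₂ → ∑ (comps y₁) (λ Q₁ → ∑ (comps y₂) (G ((a ∷ x) ∷ Q₁)))))) ⟩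
    ∑ (comps []) (λ Q₁ → ∑ (comps (a ∷ w)) (G Q₁))
      + σ w (λ p u₂ → σ p (λ x y → ∑ (comps y) (λ Q₁ → ∑ (comps u₂) (G ((a ∷ x) ∷ Q₁)))))
      ≡⟨ cong (∑ (comps []) (λ Q₁ → ∑ (comps (a ∷ w)) (G Q₁)) +_)
           (σ-cong w (λ p u₂ → comps-first a p (λ Q₁ → ∑ (comps u₂) (G Q₁)))) ⟨
    ∑ (comps []) (λ Q₁ → ∑ (comps (a ∷ w)) (G Q₁)) + σ w (λ p u₂ → ∑ (comps (a ∷ p)) (λ Q₁ → ∑ (comps u₂) (G Q₁)))
      ≡⟨ σ-∷ a w (λ u₁ u₂ → ∑ (comps u₁) (λ Q₁ → ∑ (comps u₂) (G Q₁))) ⟨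
    σ (a ∷ w) (λ u₁ u₂ → ∑ (comps u₁) (λ Q₁ → ∑ (comps u₂) (G Q₁)))  ∎
    where
    suffix-≤ : ∀ x y → x ++ y ≡ w → length y ≤ length w
    suffix-≤ x y eq = subst (length y ≤_) (trans (sym (length-++ x)) (cong length eq)) (ℕₚ.m≤n+m (length y) (length x))

sgn : Sentence n → ℤ
sgn Q = sign (length Q)

sgn-++ : (Q R : Sentence n) → sgn (Q ++ R) ≡ sgn Q * sgn R
sgn-++ []      R = sym (*-identityˡ (sgn R))
sgn-++ (q ∷ Q) R = trans (cong -_ (sgn-++ Q R)) (neg-distribˡ-* (sgn Q) (sgn R))

-- The coefficient of M_(q) in Σ_Q (-1)^ℓ(Q) Σ_{S ⪰ Q} M_S for the word u.
ε : Word n → Word n → ℤ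
ε q u = ∑ (comps u) (λ Q → sgn Q * δᵂ (flat (reverse Q)) q)

ε-[] : (q : Word n) → ε q [] ≡ 𝟘 q
ε-[] []      = refl
ε-[] (a ∷ q) = refl

∑-neg : (xs : List X) (f : X → ℤ) → ∑ xs (λ x → - f x) ≡ - ∑ xs f
∑-neg []       f = refl
∑-neg (x ∷ xs) f = trans (cong (- f x +_) (∑-neg xs f)) (sym (neg-distrib-+ (f x) (∑ xs f)))

-- After reversal the first word `a ∷ x₁` of a composition comes last, so it must be a suffix `q` of
-- `z`. It carries one sign, and the other words build `p` out of `x₂`.
ε-∷ : (z : Word n) (a : Col n) (x : Word n) →
  ε z (a ∷ x) ≡ σ x (λ x₁ x₂ → - σ z (λ p q → ε p x₂ * δᵂ q (a ∷ x₁)))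
ε-∷ z a x = trans (comps-first a x (λ Q → sgn Q * δᵂ (flat (reverse Q)) z)) (σ-cong x λ x₁ x₂ → begin
  ∑ (comps x₂) (λ Q → - sgn Q * δᵂ (flat (reverse ((a ∷ x₁) ∷ Q))) z)
    ≡⟨ ∑-cong (comps x₂) (λ Q → trans (sym (neg-distribˡ-* (sgn Q) _)) (cong (λ i → - (sgn Q * i)) (split x₁ Q))) ⟩
  ∑ (comps x₂) (λ Q → - (sgn Q * σ z (λ p q → δᵂ (flat (reverse Q)) p * δᵂ q (a ∷ x₁))))
    ≡⟨ ∑-neg (comps x₂) _ ⟩
  - ∑ (comps x₂) (λ Q → sgn Q * σ z (λ p q → δᵂ (flat (reverse Q)) p * δᵂ q (a ∷ x₁)))
    ≡⟨ cong -_ (∑-cong (comps x₂) (λ Q → trans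
         (sym (σ-*ˡ z (sgn Q) (λ p q → δᵂ (flat (reverse Q)) p * δᵂ q (a ∷ x₁))))
         (σ-cong z (λ p q → sym (*-assoc (sgn Q) (δᵂ (flat (reverse Q)) p) (δᵂ q (a ∷ x₁))))))) ⟩
  - ∑ (comps x₂) (λ Q → σ z (λ p q → sgn Q * δᵂ (flat (reverse Q)) p * δᵂ q (a ∷ x₁)))
    ≡⟨ cong -_ (sym (σ-swap z (comps x₂) (λ p q Q → sgn Q * δᵂ (flat (reverse Q)) p * δᵂ q (a ∷ x₁)))) ⟩
  - σ z (λ p q → ∑ (comps x₂) (λ Q → sgn Q * δᵂ (flat (reverse Q)) p * δᵂ q (a ∷ x₁)))
    ≡⟨ cong -_ (σ-cong z (λ p q → ∑-*ʳ (comps x₂) (λ Q → sgn Q * δᵂ (flat (reverse Q)) p) (δᵂ q (a ∷ x₁)))) ⟩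
  - σ z (λ p q → ε p x₂ * δᵂ q (a ∷ x₁)) ∎)
  where
  split : ∀ x₁ Q → δᵂ (flat (reverse ((a ∷ x₁) ∷ Q))) z ≡
    σ z (λ p q → δᵂ (flat (reverse Q)) p * δᵂ q (a ∷ x₁))
  split x₁ Q = begin
    δᵂ (flat (reverse ((a ∷ x₁) ∷ Q))) z  ≡⟨ cong (λ v → δᵂ v z) (flat-reverse-∷ (a ∷ x₁) Q) ⟩
    δᵂ (flat (reverse Q) ++ a ∷ x₁) z     ≡⟨ δᵂ-sym (flat (reverse Q) ++ a ∷ x₁) z ⟩
    δᵂ z (flat (reverse Q) ++ a ∷ x₁)     ≡⟨ δᵂ-++ z (flat (reverse Q)) (a ∷ x₁) ⟨
    σ z (λ p q → δᵂ p (flat (reverse Q)) * δᵂ q (a ∷ x₁))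
      ≡⟨ σ-cong z (λ p q → cong (_* δᵂ q (a ∷ x₁)) (δᵂ-sym p (flat (reverse Q)))) ⟩
    σ z (λ p q → δᵂ (flat (reverse Q)) p * δᵂ q (a ∷ x₁)) ∎

δᵂ-[] : (q : Word n) → δᵂ q [] ≡ 𝟘 q
δᵂ-[] []      = refl
δᵂ-[] (a ∷ q) = refl

ε-[]ˡ : (u : Word n) → ε [] u ≡ 𝟘 u
ε-[]ˡ []      = refl
ε-[]ˡ (a ∷ u) = trans (ε-∷ [] a u) (σ-vanish u λ x y →
  cong -_ (trans (σ-[] (λ p q → ε p y * δᵂ q (a ∷ x))) (*-zeroʳ (ε [] y))))

-- Moving the last factor of z = q₁⋯qᵢ · q to the end of x = q · qᵢ⋯q₁ pairs the terms off with opposite signs.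
ε-cancel : (z x : Word n) →
  σ z (λ p q → σ x (λ x₁ x₂ → δᵂ q x₁ * ε p x₂)) ≡ 𝟘 z * 𝟘 x
ε-cancel z []      = begin
  σ z (λ p q → σ [] (λ x₁ x₂ → δᵂ q x₁ * ε p x₂))
    ≡⟨ σ-cong z (λ p q → trans (σ-[] (λ x₁ x₂ → δᵂ q x₁ * ε p x₂))
         (trans (cong₂ _*_ (δᵂ-[] q) (ε-[] p)) (*-comm (𝟘 q) (𝟘 p)))) ⟩
  σ z (λ p q → 𝟘 p * 𝟘 q)  ≡⟨ σ-𝟘ˡ z 𝟘 ⟩
  𝟘 z                      ≡⟨ *-identityʳ (𝟘 z) ⟨
  𝟘 z * 1ℤ                 ∎
ε-cancel z (a ∷ x) = begin
  σ z (λ p q → σ (a ∷ x) (λ x₁ x₂ → δᵂ q x₁ * ε p x₂))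
    ≡⟨ σ-cong z (λ p q → σ-∷ a x (λ x₁ x₂ → δᵂ q x₁ * ε p x₂)) ⟩
  σ z (λ p q → δᵂ q [] * ε p (a ∷ x) + σ x (λ x₁ x₂ → δᵂ q (a ∷ x₁) * ε p x₂))
    ≡⟨ σ-+ z (λ p q → δᵂ q [] * ε p (a ∷ x)) (λ p q → σ x (λ x₁ x₂ → δᵂ q (a ∷ x₁) * ε p x₂)) ⟩
  σ z (λ p q → δᵂ q [] * ε p (a ∷ x)) + σ z (λ p q → σ x (λ x₁ x₂ → δᵂ q (a ∷ x₁) * ε p x₂))
    ≡⟨ cong₂ _+_
         (σ-cong z (λ p q → trans (cong (_* ε p (a ∷ x)) (δᵂ-[] q)) (*-comm (𝟘 q) (ε p (a ∷ x)))))
         (trans (σ-swap z (splits x) (λ p q x₁₂ → δᵂ q (a ∷ proj₁ x₁₂) * ε p (proj₂ x₁₂)))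
           (σ-cong x (λ x₁ x₂ → σ-cong z (λ p q → *-comm (δᵂ q (a ∷ x₁)) (ε p x₂))))) ⟩
  σ z (λ p q → ε p (a ∷ x) * 𝟘 q) + σ x (λ x₁ x₂ → σ z (λ p q → ε p x₂ * δᵂ q (a ∷ x₁)))
    ≡⟨ cong (_+ σ x (λ x₁ x₂ → σ z (λ p q → ε p x₂ * δᵂ q (a ∷ x₁))))
         (trans (σ-𝟘ʳ z (λ p → ε p (a ∷ x))) (trans (ε-∷ z a x) (∑-neg (splits x) _))) ⟩
  - σ x (λ x₁ x₂ → σ z (λ p q → ε p x₂ * δᵂ q (a ∷ x₁))) + σ x (λ x₁ x₂ → σ z (λ p q → ε p x₂ * δᵂ q (a ∷ x₁)))
    ≡⟨ +-inverseˡ (σ x (λ x₁ x₂ → σ z (λ p q → ε p x₂ * δᵂ q (a ∷ x₁)))) ⟩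
  0ℤ
    ≡⟨ *-zeroʳ (𝟘 z) ⟨
  𝟘 z * 0ℤ  ∎

#coarsen : Sentence n → Sentence n → ℤ
#coarsen Q S = ∑ (coarsen Q) (λ R → δˢ R S)

#coarsen-∷ : (Q : Sentence n) (q : NWord n) (S : Sentence n) →
  #coarsen Q (q ∷ S) ≡ σ Q (λ R Q′ → δᵂ (flat R) (toList q) * #coarsen Q′ S)
#coarsen-∷ []       q S = refl
#coarsen-∷ (p ∷ Q) q S = begin
  #coarsen (p ∷ Q) (q ∷ S)
    ≡⟨ coarsen-first p Q (λ R → δˢ R (q ∷ S)) ⟩
  σ Q (λ R Q′ → ∑ (coarsen Q′) (λ S′ → δˢ ((p ⁺++ flat R) ∷ S′) (q ∷ S)))
    ≡⟨ σ-cong Q (λ R Q′ → trans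
         (∑-cong (coarsen Q′) (λ S′ → δᵂˢ-∷ (toList p ++ flat R) (toW S′) (toList q) (toW S)))
         (∑-*ˡ (coarsen Q′) (δᵂ (toList p ++ flat R) (toList q)) (λ S′ → δˢ S′ S))) ⟩
  σ Q (λ R Q′ → δᵂ (flat (p ∷ R)) (toList q) * #coarsen Q′ S)
    -- The summand `R = []` is zero because `q` is nonempty; it completes the sum to all cuts of
    -- `p ∷ Q`.
    ≡⟨ +-identityˡ _ ⟨
  0ℤ + σ Q (λ R Q′ → δᵂ (flat (p ∷ R)) (toList q) * #coarsen Q′ S)
    ≡⟨ σ-∷ p Q (λ R Q′ → δᵂ (flat R) (toList q) * #coarsen Q′ S) ⟨
  σ (p ∷ Q) (λ R Q′ → δᵂ (flat R) (toList q) * #coarsen Q′ S)  ∎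

#coarsen-∷ʳ-[] : (Q : Sentence n) (q : NWord n) → #coarsen (Q ++ q ∷ []) [] ≡ 0ℤ
#coarsen-∷ʳ-[] []      q = refl
#coarsen-∷ʳ-[] (p ∷ Q) q = trans (coarsen-first p (Q ++ q ∷ []) (λ R → δˢ R []))
  (σ-vanish (Q ++ q ∷ []) (λ _ Q′ → ∑-vanish (coarsen Q′) (λ _ → refl)))

-- The coefficient of M_S in Σ_Q (-1)^ℓ(Q) Σ_{S ⪰ Q} M_S for the word u.
η : Word n → Sentence n → ℤ
η u S = ∑ (comps u) (λ Q → sgn Q * #coarsen (reverse Q) S)

η-[] : (u : Word n) → η u [] ≡ 𝟘 u
η-[] []      = refl
η-[] (a ∷ u) = trans (comps-first a u (λ Q → sgn Q * #coarsen (reverse Q) []))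
  (σ-vanish u (λ x y → ∑-vanish (comps y) (λ Q →
    trans (cong (λ R → sgn ((a ∷ x) ∷ Q) * #coarsen R []) (unfold-reverse (a ∷ x) Q))
      (trans (cong (sgn ((a ∷ x) ∷ Q) *_) (#coarsen-∷ʳ-[] (reverse Q) (a ∷ x))) (*-zeroʳ (sgn ((a ∷ x) ∷ Q)))))))

-- The first word of a coarsening of `reverse Q` joins the reversal of a final block of `Q`, whose
-- letters form a suffix `u₂` of `u`. The sign is multiplicative, so the contributions of the two
-- blocks separate.
η-∷ : (u : Word n) (q : NWord n) (S : Sentence n) →
  η u (q ∷ S) ≡ σ u (λ u₁ u₂ → η u₁ S * ε (toList q) u₂)
η-∷ u q S = begin
  η u (q ∷ S)
    ≡⟨ ∑-cong (comps u) (λ Q → begin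
         sgn Q * #coarsen (reverse Q) (q ∷ S)
           ≡⟨ cong (sgn Q *_) (trans (#coarsen-∷ (reverse Q) q S)
                (σ-reverse Q (λ R Q′ → δᵂ (flat R) (toList q) * #coarsen Q′ S))) ⟩
         sgn Q * σ Q (λ Q₁ Q₂ → δᵂ (flat (reverse Q₂)) (toList q) * #coarsen (reverse Q₁) S)
           ≡⟨ σ-*ˡ Q (sgn Q) (λ Q₁ Q₂ → δᵂ (flat (reverse Q₂)) (toList q) * #coarsen (reverse Q₁) S) ⟨
         σ Q (λ Q₁ Q₂ → sgn Q * (δᵂ (flat (reverse Q₂)) (toList q) * #coarsen (reverse Q₁) S))
           ≡⟨ σ-cong-++ Q (λ Q₁ Q₂ eq → trans
                (cong (_* (δᵂ (flat (reverse Q₂)) (toList q) * #coarsen (reverse Q₁) S))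
                  (trans (cong sgn (sym eq)) (sgn-++ Q₁ Q₂)))
                (shuffle (sgn Q₁) (sgn Q₂) (δᵂ (flat (reverse Q₂)) (toList q)) (#coarsen (reverse Q₁) S))) ⟩
         σ Q (λ Q₁ Q₂ → sgn Q₁ * #coarsen (reverse Q₁) S * (sgn Q₂ * δᵂ (flat (reverse Q₂)) (toList q)))  ∎) ⟩
  ∑ (comps u) (λ Q → σ Q (λ Q₁ Q₂ → A Q₁ * B Q₂))
    ≡⟨ comps-splits u (λ Q₁ Q₂ → A Q₁ * B Q₂) ⟩
  σ u (λ u₁ u₂ → ∑ (comps u₁) (λ Q₁ → ∑ (comps u₂) (λ Q₂ → A Q₁ * B Q₂)))
    ≡⟨ σ-cong u (λ u₁ u₂ → trans (∑-cong (comps u₁) (λ Q₁ → ∑-*ˡ (comps u₂) (A Q₁) B))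
         (∑-*ʳ (comps u₁) A (ε (toList q) u₂))) ⟩
  σ u (λ u₁ u₂ → η u₁ S * ε (toList q) u₂)  ∎
  where
  A B : Sentence _ → ℤ
  A Q = sgn Q * #coarsen (reverse Q) S
  B Q = sgn Q * δᵂ (flat (reverse Q)) (toList q)
  shuffle : ∀ a b c d → a * b * (c * d) ≡ a * d * (b * c)
  shuffle = solve-∀

-- Empty words obey the recursion of `η-∷` too, because `ε []` is the counit. Hence `η` can be
-- computed position by position on a weak sentence.
η-dropEmpty : (u q : Word n) (m : WSent n) →
  η u (dropEmpty (q ∷ m)) ≡ σ u (λ u₁ u₂ → η u₁ (dropEmpty m) * ε q u₂)
η-dropEmpty u []      m = begin
  η u (dropEmpty m)                                ≡⟨ σ-𝟘ʳ u (λ u₁ → η u₁ (dropEmpty m)) ⟨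
  σ u (λ u₁ u₂ → η u₁ (dropEmpty m) * 𝟘 u₂)        ≡⟨ σ-cong u (λ u₁ u₂ → cong (η u₁ (dropEmpty m) *_) (ε-[]ˡ u₂)) ⟨
  σ u (λ u₁ u₂ → η u₁ (dropEmpty m) * ε [] u₂)     ∎
η-dropEmpty u (a ∷ q) m = η-∷ u (a ∷ q) (dropEmpty m)

-- Factorizations and the collapse of Σ e_u^⊥ h_t^⊥

wordSplits≡splits : (u : Word n) → wordSplits u ≡ splits u
wordSplits≡splits u = trans (map-applyUpTo (λ k → k) (λ k → take k u , drop k u) (suc (length u))) (go u)
  where
  go : ∀ u → applyUpTo (λ k → take k u , drop k u) (suc (length u)) ≡ splits u
  go []      = refl
  go (a ∷ u) = cong (([] , a ∷ u) ∷_) (trans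
    (sym (map-applyUpTo (λ k → take k u , drop k u) (λ (p , q) → (a ∷ p , q)) (suc (length u))))
    (cong (map (λ (p , q) → (a ∷ p , q))) (go u)))

factorizations-∷ : (w : Word n) (m : WSent n) → factorizations (w ∷ m) ≡
  concatMap (λ (p , q) → map (λ (m₁ , m₂) → (p ∷ m₁ , q ∷ m₂)) (factorizations m)) (splits w)
factorizations-∷ w m = cong (concatMap _) (wordSplits≡splits w)

𝓕 : WSent n → (WSent n → WSent n → ℤ) → ℤ
𝓕 m G = ∑ (factorizations m) (uncurry G)

𝓕-∷ : (w : Word n) (m : WSent n) (G : WSent n → WSent n → ℤ) →
  𝓕 (w ∷ m) G ≡ σ w (λ p q → 𝓕 m (λ m₁ m₂ → G (p ∷ m₁) (q ∷ m₂)))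
𝓕-∷ w m G = trans (cong (λ fs → ∑ fs (uncurry G)) (factorizations-∷ w m)) (trans
  (∑-concatMap (λ (p , q) → map (λ (m₁ , m₂) → (p ∷ m₁ , q ∷ m₂)) (factorizations m)) (splits w) (uncurry G))
  (σ-cong w (λ p q → ∑-map (λ (m₁ , m₂) → (p ∷ m₁ , q ∷ m₂)) (factorizations m) (uncurry G))))

𝓕-cong : {G G′ : WSent n → WSent n → ℤ} (m : WSent n) → (∀ m₁ m₂ → G m₁ m₂ ≡ G′ m₁ m₂) → 𝓕 m G ≡ 𝓕 m G′
𝓕-cong m eq = ∑-cong (factorizations m) (uncurry eq)

𝓕-*ˡ : (m : WSent n) (c : ℤ) (G : WSent n → WSent n → ℤ) → 𝓕 m (λ m₁ m₂ → c * G m₁ m₂) ≡ c * 𝓕 m G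
𝓕-*ˡ m c G = ∑-*ˡ (factorizations m) c (uncurry G)

𝓕-σ-swap : (m : WSent n) (u : List X) (G : WSent n → WSent n → List X → List X → ℤ) →
  𝓕 m (λ m₁ m₂ → σ u (G m₁ m₂)) ≡ σ u (λ p q → 𝓕 m (λ m₁ m₂ → G m₁ m₂ p q))
𝓕-σ-swap m u G = ∑-swap (factorizations m) (splits u) (λ (m₁ , m₂) (p , q) → G m₁ m₂ p q)

σ-σ-swap : (u : List X) (v : List Y) (G : List X → List X → List Y → List Y → ℤ) →
  σ u (λ p q → σ v (G p q)) ≡ σ v (λ r s → σ u (λ p q → G p q r s))
σ-σ-swap u v G = ∑-swap (splits u) (splits v) (λ (p , q) (r , s) → G p q r s)

-- H_p · f has coefficient headCoeff p K * f (dropHead p K) at H_K, where H_∅ = 1.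
headCoeff : Word n → Sentence n → ℤ
headCoeff []      K       = 1ℤ
headCoeff (a ∷ p) []      = 0ℤ
headCoeff (a ∷ p) (x ∷ K) = δᵂ (a ∷ p) (toList x)

dropHead : Word n → Sentence n → Sentence n
dropHead []      K       = K
-- This case is always multiplied by `headCoeff (a ∷ p) [] = 0`.
dropHead (a ∷ p) []      = []
dropHead (a ∷ p) (x ∷ K) = K

δˢ-dropEmpty : (p : Word n) (m : WSent n) (K : Sentence n) →
  δˢ (dropEmpty (p ∷ m)) K ≡ headCoeff p K * δˢ (dropEmpty m) (dropHead p K)
δˢ-dropEmpty []      m K       = sym (*-identityˡ (δˢ (dropEmpty m) K))
δˢ-dropEmpty (a ∷ p) m []      = refl
δˢ-dropEmpty (a ∷ p) m (x ∷ K) = δᵂˢ-∷ (a ∷ p) (toW (dropEmpty m)) (toList x) (toW K)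

-- The coefficient of H_K in Σ_Q (-1)^ℓ(Q) Σ_{S ⪰ Q} M_S^⊥ (H_m) for the word u.
innerH : Word n → WSent n → Sentence n → ℤ
innerH u m K = 𝓕 m (λ m₁ m₂ → δˢ (dropEmpty m₁) K * η u (dropEmpty m₂))

innerH-[] : (u : Word n) (K : Sentence n) → innerH u [] K ≡ δˢ [] K * 𝟘 u
innerH-[] u K = trans (+-identityʳ _) (cong (δˢ [] K *_) (η-[] u))

-- The operator keeps `p` and removes `q` from `w`. What it removes uses up the end `u₂` of `u`, and
-- the later words of `m` use up the beginning `u₁`, by the reversed order in `η-∷`.
innerH-∷ : (u w : Word n) (m : WSent n) (K : Sentence n) →
  innerH u (w ∷ m) K ≡
  σ w (λ p q → headCoeff p K * σ u (λ u₁ u₂ → ε q u₂ * innerH u₁ m (dropHead p K)))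
innerH-∷ u w m K = trans (𝓕-∷ w m (λ m₁ m₂ → δˢ (dropEmpty m₁) K * η u (dropEmpty m₂))) (σ-cong w λ p q → begin
  𝓕 m (λ m₁ m₂ → δˢ (dropEmpty (p ∷ m₁)) K * η u (dropEmpty (q ∷ m₂)))
    ≡⟨ 𝓕-cong m (λ m₁ m₂ → trans (cong₂ _*_ (δˢ-dropEmpty p m₁ K) (η-dropEmpty u q m₂))
         (*-assoc (headCoeff p K) (D p m₁) (σ u (λ u₁ u₂ → η u₁ (dropEmpty m₂) * ε q u₂)))) ⟩
  𝓕 m (λ m₁ m₂ → headCoeff p K * (D p m₁ * σ u (λ u₁ u₂ → η u₁ (dropEmpty m₂) * ε q u₂)))
    ≡⟨ 𝓕-*ˡ m (headCoeff p K) (λ m₁ m₂ → D p m₁ * σ u (λ u₁ u₂ → η u₁ (dropEmpty m₂) * ε q u₂)) ⟩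
  headCoeff p K * 𝓕 m (λ m₁ m₂ → D p m₁ * σ u (λ u₁ u₂ → η u₁ (dropEmpty m₂) * ε q u₂))
    ≡⟨ cong (headCoeff p K *_) (𝓕-cong m (λ m₁ m₂ → trans
         (sym (σ-*ˡ u (D p m₁) (λ u₁ u₂ → η u₁ (dropEmpty m₂) * ε q u₂)))
         (σ-cong u (λ u₁ u₂ → shuffle (D p m₁) (η u₁ (dropEmpty m₂)) (ε q u₂))))) ⟩
  headCoeff p K * 𝓕 m (λ m₁ m₂ → σ u (λ u₁ u₂ → ε q u₂ * (D p m₁ * η u₁ (dropEmpty m₂))))
    ≡⟨ cong (headCoeff p K *_) (trans
         (𝓕-σ-swap m u (λ m₁ m₂ u₁ u₂ → ε q u₂ * (D p m₁ * η u₁ (dropEmpty m₂))))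
         (σ-cong u (λ u₁ u₂ → 𝓕-*ˡ m (ε q u₂) (λ m₁ m₂ → D p m₁ * η u₁ (dropEmpty m₂))))) ⟩
  headCoeff p K * σ u (λ u₁ u₂ → ε q u₂ * innerH u₁ m (dropHead p K))  ∎)
  where
  D : Word _ → WSent _ → ℤ
  D p m₁ = δˢ (dropEmpty m₁) (dropHead p K)
  shuffle : ∀ a b c → a * (b * c) ≡ c * (a * b)
  shuffle = solve-∀

-- Both sums split t into four factors a · b · u₁ · u₂.
σ-regroup : (t : List X) (f g h k : List X → ℤ) →
  σ t (λ t₁ u → σ t₁ (λ a b → f a * g b) * σ u (λ u₁ u₂ → k u₂ * h u₁)) ≡
  σ t (λ a s → f a * σ s (λ s₁ u₂ → k u₂ * σ s₁ (λ b u₁ → g b * h u₁)))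
σ-regroup t f g h k = begin
  σ t (λ t₁ u → σ t₁ (λ a b → f a * g b) * σ u (λ u₁ u₂ → k u₂ * h u₁))
    ≡⟨ σ-cong t (λ t₁ u → trans
         (sym (σ-*ʳ t₁ (λ a b → f a * g b) (σ u (λ u₁ u₂ → k u₂ * h u₁))))
         (σ-cong t₁ (λ a b → *-assoc (f a) (g b) (σ u (λ u₁ u₂ → k u₂ * h u₁))))) ⟩
  σ t (λ t₁ u → σ t₁ (λ a b → f a * (g b * σ u (λ u₁ u₂ → k u₂ * h u₁))))
    ≡⟨ σ-assoc t (λ a b u → f a * (g b * σ u (λ u₁ u₂ → k u₂ * h u₁))) ⟩
  σ t (λ a s → σ s (λ b u → f a * (g b * σ u (λ u₁ u₂ → k u₂ * h u₁))))
    ≡⟨ σ-cong t (λ a s → trans (σ-*ˡ s (f a) (λ b u → g b * σ u (λ u₁ u₂ → k u₂ * h u₁))) (cong (f a *_) (begin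
      σ s (λ b u → g b * σ u (λ u₁ u₂ → k u₂ * h u₁))
        ≡⟨ σ-cong s (λ b u → sym (σ-*ˡ u (g b) (λ u₁ u₂ → k u₂ * h u₁))) ⟩
      σ s (λ b u → σ u (λ u₁ u₂ → g b * (k u₂ * h u₁)))
        ≡⟨ σ-assoc s (λ b u₁ u₂ → g b * (k u₂ * h u₁)) ⟨
      σ s (λ s₁ u₂ → σ s₁ (λ b u₁ → g b * (k u₂ * h u₁)))
        ≡⟨ σ-cong s (λ s₁ u₂ → trans (σ-cong s₁ (λ b u₁ → shuffle (g b) (k u₂) (h u₁)))
             (σ-*ˡ s₁ (k u₂) (λ b u₁ → g b * h u₁))) ⟩
      σ s (λ s₁ u₂ → k u₂ * σ s₁ (λ b u₁ → g b * h u₁))  ∎))) ⟩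
  σ t (λ a s → f a * σ s (λ s₁ u₂ → k u₂ * σ s₁ (λ b u₁ → g b * h u₁)))  ∎
  where
  shuffle : ∀ a b c → a * (b * c) ≡ b * (a * c)
  shuffle = solve-∀

-- The coefficients of Σ_{t = t₁u} e_u^⊥ h_{t₁}^⊥ (H_m), where h_t = Σ_{I a composition of t} M_I.
Γ : Word n → WSent n → Sentence n → ℤ
Γ t m K = 𝓕 m (λ m₁ m₂ → σ t (λ t₁ u → δᵂ t₁ (concat m₂) * innerH u m₁ K))

-- Here `w` is cut into `p₁`, `p₂`, `q`: h^⊥ takes `q`, e^⊥ takes `p₂`, and `p₁` survives. Dually
-- `t` is cut into `a`, `s₁`, `u₂`, with `a = q` in front and `u₂` weighted by `ε p₂` at the end.
-- All that is taken from `m` lies in `s₁`, so the inner factor is again a `Γ`.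
Γ-∷ : (t w : Word n) (m : WSent n) (K : Sentence n) →
  Γ t (w ∷ m) K ≡
  σ w (λ p q → σ p (λ p₁ p₂ → headCoeff p₁ K *
    σ t (λ a s → δᵂ a q * σ s (λ s₁ u₂ → ε p₂ u₂ * Γ s₁ m (dropHead p₁ K)))))
Γ-∷ t w m K = trans (𝓕-∷ w m (λ m₁ m₂ → σ t (λ t₁ u → δᵂ t₁ (concat m₂) * innerH u m₁ K))) (σ-cong w λ p q → begin
  𝓕 m (λ m₁ m₂ → σ t (λ t₁ u → δᵂ t₁ (q ++ concat m₂) * innerH u (p ∷ m₁) K))
    ≡⟨ 𝓕-cong m (λ m₁ m₂ → peel p q m₁ m₂) ⟩
  𝓕 m (λ m₁ m₂ → σ p (λ p₁ p₂ → headCoeff p₁ K * σ t (λ a s → δᵂ a q * σ s (λ s₁ u₂ → ε p₂ u₂ * γ s₁ m₁ m₂ p₁))))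
    ≡⟨ 𝓕-σ-swap m p _ ⟩
  σ p (λ p₁ p₂ → 𝓕 m (λ m₁ m₂ → headCoeff p₁ K * σ t (λ a s → δᵂ a q * σ s (λ s₁ u₂ → ε p₂ u₂ * γ s₁ m₁ m₂ p₁))))
    ≡⟨ σ-cong p (λ p₁ p₂ → trans
         (𝓕-*ˡ m (headCoeff p₁ K) (λ m₁ m₂ → σ t (λ a s → δᵂ a q * σ s (λ s₁ u₂ → ε p₂ u₂ * γ s₁ m₁ m₂ p₁))))
         (cong (headCoeff p₁ K *_) (trans
           (𝓕-σ-swap m t (λ m₁ m₂ a s → δᵂ a q * σ s (λ s₁ u₂ → ε p₂ u₂ * γ s₁ m₁ m₂ p₁)))
           (σ-cong t (λ a s → trans
             (𝓕-*ˡ m (δᵂ a q) (λ m₁ m₂ → σ s (λ s₁ u₂ → ε p₂ u₂ * γ s₁ m₁ m₂ p₁)))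
             (cong (δᵂ a q *_) (trans
               (𝓕-σ-swap m s (λ m₁ m₂ s₁ u₂ → ε p₂ u₂ * γ s₁ m₁ m₂ p₁))
               (σ-cong s (λ s₁ u₂ → 𝓕-*ˡ m (ε p₂ u₂) (λ m₁ m₂ → γ s₁ m₁ m₂ p₁)))))))))) ⟩
  σ p (λ p₁ p₂ → headCoeff p₁ K *
    σ t (λ a s → δᵂ a q * σ s (λ s₁ u₂ → ε p₂ u₂ * Γ s₁ m (dropHead p₁ K))))  ∎)
  where
  γ : Word _ → WSent _ → WSent _ → Word _ → ℤ
  γ s₁ m₁ m₂ p₁ = σ s₁ (λ b u₁ → δᵂ b (concat m₂) * innerH u₁ m₁ (dropHead p₁ K))
  shuffle : ∀ a b c → a * (b * c) ≡ b * (a * c)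
  shuffle = solve-∀
  peel : ∀ p q m₁ m₂ →
    σ t (λ t₁ u → δᵂ t₁ (q ++ concat m₂) * innerH u (p ∷ m₁) K) ≡
    σ p (λ p₁ p₂ → headCoeff p₁ K * σ t (λ a s → δᵂ a q * σ s (λ s₁ u₂ → ε p₂ u₂ * γ s₁ m₁ m₂ p₁)))
  peel p q m₁ m₂ = begin
    σ t (λ t₁ u → δᵂ t₁ (q ++ concat m₂) * innerH u (p ∷ m₁) K)
      ≡⟨ σ-cong t (λ t₁ u → cong₂ _*_ (sym (δᵂ-++ t₁ q (concat m₂))) (innerH-∷ u p m₁ K)) ⟩
    σ t (λ t₁ u → L t₁ * σ p (λ p₁ p₂ → headCoeff p₁ K * R u p₁ p₂))
      ≡⟨ σ-cong t (λ t₁ u → trans (sym (σ-*ˡ p (L t₁) (λ p₁ p₂ → headCoeff p₁ K * R u p₁ p₂)))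
           (σ-cong p (λ p₁ p₂ → shuffle (L t₁) (headCoeff p₁ K) (R u p₁ p₂)))) ⟩
    σ t (λ t₁ u → σ p (λ p₁ p₂ → headCoeff p₁ K * (L t₁ * R u p₁ p₂)))
      ≡⟨ σ-σ-swap t p (λ t₁ u p₁ p₂ → headCoeff p₁ K * (L t₁ * R u p₁ p₂)) ⟩
    σ p (λ p₁ p₂ → σ t (λ t₁ u → headCoeff p₁ K * (L t₁ * R u p₁ p₂)))
      ≡⟨ σ-cong p (λ p₁ p₂ → trans (σ-*ˡ t (headCoeff p₁ K) (λ t₁ u → L t₁ * R u p₁ p₂))
           (cong (headCoeff p₁ K *_) (σ-regroup t (λ a → δᵂ a q) (λ b → δᵂ b (concat m₂))
             (λ u₁ → innerH u₁ m₁ (dropHead p₁ K)) (ε p₂)))) ⟩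
    σ p (λ p₁ p₂ → headCoeff p₁ K * σ t (λ a s → δᵂ a q * σ s (λ s₁ u₂ → ε p₂ u₂ * γ s₁ m₁ m₂ p₁)))  ∎
    where
    L : Word _ → ℤ
    L t₁ = σ t₁ (λ a b → δᵂ a q * δᵂ b (concat m₂))
    R : Word _ → Word _ → Word _ → ℤ
    R u p₁ p₂ = σ u (λ u₁ u₂ → ε p₂ u₂ * innerH u₁ m₁ (dropHead p₁ K))

-- By induction the middle piece `s₁` is empty. What remains is a double sum over the cuts of `t`
-- and of the suffix `z` removed from `w`, which is `ε-cancel z t`; only `z` and `t` both empty
-- survive.
Γ-collapse : (t : Word n) (m : WSent n) (K : Sentence n) → Γ t m K ≡ 𝟘 t * δˢ (dropEmpty m) K
Γ-collapse t [] K = begin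
  σ t (λ t₁ u → δᵂ t₁ [] * innerH u [] K) + 0ℤ
    ≡⟨ +-identityʳ _ ⟩
  σ t (λ t₁ u → δᵂ t₁ [] * innerH u [] K)
    ≡⟨ σ-cong t (λ t₁ u → cong₂ _*_ (δᵂ-[] t₁) (innerH-[] u K)) ⟩
  σ t (λ t₁ u → 𝟘 t₁ * (δˢ [] K * 𝟘 u))
    ≡⟨ σ-𝟘ˡ t (λ u → δˢ [] K * 𝟘 u) ⟩
  δˢ [] K * 𝟘 t
    ≡⟨ *-comm (δˢ [] K) (𝟘 t) ⟩
  𝟘 t * δˢ [] K  ∎
Γ-collapse t (w ∷ m) K = begin
  Γ t (w ∷ m) K
    ≡⟨ Γ-∷ t w m K ⟩
  σ w (λ p q → σ p (λ p₁ p₂ → headCoeff p₁ K *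
    σ t (λ a s → δᵂ a q * σ s (λ s₁ u₂ → ε p₂ u₂ * Γ s₁ m (dropHead p₁ K)))))
    ≡⟨ σ-cong w (λ p q → σ-cong p (λ p₁ p₂ → cong (headCoeff p₁ K *_) (begin
      σ t (λ a s → δᵂ a q * σ s (λ s₁ u₂ → ε p₂ u₂ * Γ s₁ m (dropHead p₁ K)))
        ≡⟨ σ-cong t (λ a s → cong (δᵂ a q *_) (trans
             (σ-cong s (λ s₁ u₂ → trans (cong (ε p₂ u₂ *_) (Γ-collapse s₁ m (dropHead p₁ K)))
               (shuffle (ε p₂ u₂) (𝟘 s₁) (D p₁))))
             (σ-𝟘ˡ s (λ u₂ → ε p₂ u₂ * D p₁)))) ⟩
      σ t (λ a s → δᵂ a q * (ε p₂ s * D p₁))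
        ≡⟨ trans (σ-cong t (λ a s → sym (*-assoc (δᵂ a q) (ε p₂ s) (D p₁))))
             (σ-*ʳ t (λ a s → δᵂ a q * ε p₂ s) (D p₁)) ⟩
      σ t (λ a s → δᵂ a q * ε p₂ s) * D p₁  ∎))) ⟩
  σ w (λ p q → σ p (λ p₁ p₂ → headCoeff p₁ K * (W p₂ q * D p₁)))
    ≡⟨ σ-assoc w (λ p₁ p₂ q → headCoeff p₁ K * (W p₂ q * D p₁)) ⟩
  σ w (λ p₁ z → σ z (λ p₂ q → headCoeff p₁ K * (W p₂ q * D p₁)))
    ≡⟨ σ-cong w (λ p₁ z → trans (σ-*ˡ z (headCoeff p₁ K) (λ p₂ q → W p₂ q * D p₁))
         (cong (headCoeff p₁ K *_) (trans (σ-*ʳ z W (D p₁)) (cong (_* D p₁) (trans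
           (σ-cong z (λ p₂ q → σ-cong t (λ a s → cong (_* ε p₂ s) (δᵂ-sym a q))))
           (ε-cancel z t)))))) ⟩
  σ w (λ p₁ z → headCoeff p₁ K * (𝟘 z * 𝟘 t * D p₁))
    ≡⟨ σ-cong w (λ p₁ z → shuffle′ (headCoeff p₁ K) (𝟘 z) (𝟘 t) (D p₁)) ⟩
  σ w (λ p₁ z → 𝟘 t * (headCoeff p₁ K * D p₁) * 𝟘 z)
    ≡⟨ σ-𝟘ʳ w (λ p₁ → 𝟘 t * (headCoeff p₁ K * D p₁)) ⟩
  𝟘 t * (headCoeff w K * D w)
    ≡⟨ cong (𝟘 t *_) (δˢ-dropEmpty w m K) ⟨
  𝟘 t * δˢ (dropEmpty (w ∷ m)) K  ∎
  where
  D : Word _ → ℤ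
  D p₁ = δˢ (dropEmpty m) (dropHead p₁ K)
  W : Word _ → Word _ → ℤ
  W p₂ q = σ t (λ a s → δᵂ a q * ε p₂ s)
  shuffle : ∀ a b c → a * (b * c) ≡ b * (a * c)
  shuffle = solve-∀
  shuffle′ : ∀ a b c d → a * (b * c * d) ≡ c * (a * d) * b
  shuffle′ = solve-∀

-- The creation operators and the expansion of H

∑-allFin-suc : (f : Fin (suc n) → ℤ) → ∑ (tabulate Fin.suc) f ≡ ∑ (allFin n) (f ∘ Fin.suc)
∑-allFin-suc {n} f = trans
  (cong (λ xs → ∑ xs f) (sym (map-tabulate {n = n} (λ a → a) Fin.suc)))
  (∑-map Fin.suc (allFin n) f)

∑-allFin-𝟙 : (c : Fin n) → ∑ (allFin n) (λ a → 𝟙 (a ≟F c)) ≡ 1ℤ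
∑-allFin-𝟙 {suc n} Fin.zero    =
  cong (1ℤ +_) (trans (∑-allFin-suc {n} (λ a → 𝟙 (a ≟F Fin.zero))) (∑-zero (allFin n)))
∑-allFin-𝟙 {suc n} (Fin.suc c) =
  trans (+-identityˡ _) (trans (∑-allFin-suc (λ a → 𝟙 (a ≟F Fin.suc c))) (∑-allFin-𝟙 c))

∑-wordsOfLength-δ : (d : ℕ) (x : Word n) → ∑ (wordsOfLength n d) (λ u → δᵂ u x) ≡ 𝟙 (length x ≟ℕ d)
∑-wordsOfLength-δ zero    []      = refl
∑-wordsOfLength-δ zero    (c ∷ x) = refl
∑-wordsOfLength-δ {n} (suc d) x = trans
  (∑-concatMap (λ a → map (a ∷_) (wordsOfLength n d)) (allFin n) (λ u → δᵂ u x))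
  (trans (∑-cong (allFin n) (λ a → ∑-map (a ∷_) (wordsOfLength n d) (λ u → δᵂ u x))) (go x))
  where
  go : ∀ x → ∑ (allFin n) (λ a → ∑ (wordsOfLength n d) (λ u → δᵂ (a ∷ u) x)) ≡ 𝟙 (length x ≟ℕ suc d)
  go []      = ∑-vanish (allFin n) (λ a → ∑-zero (wordsOfLength n d))
  go (c ∷ x) = begin
    ∑ (allFin n) (λ a → ∑ (wordsOfLength n d) (λ u → δᵂ (a ∷ u) (c ∷ x)))
      ≡⟨ ∑-cong (allFin n) (λ a → trans
           (∑-cong (wordsOfLength n d) (λ u → Delta.δ-∷ _≟F_ a u c x))
           (∑-*ˡ (wordsOfLength n d) (𝟙 (a ≟F c)) (λ u → δᵂ u x))) ⟩
    ∑ (allFin n) (λ a → 𝟙 (a ≟F c) * ∑ (wordsOfLength n d) (λ u → δᵂ u x))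
      ≡⟨ ∑-*ʳ (allFin n) (λ a → 𝟙 (a ≟F c)) _ ⟩
    ∑ (allFin n) (λ a → 𝟙 (a ≟F c)) * ∑ (wordsOfLength n d) (λ u → δᵂ u x)
      ≡⟨ cong₂ _*_ (∑-allFin-𝟙 c) (∑-wordsOfLength-δ d x) ⟩
    1ℤ * 𝟙 (length x ≟ℕ d)
      ≡⟨ *-identityˡ _ ⟩
    𝟙 (length x ≟ℕ d)  ∎

∑-comps-δ : (u : Word n) (I : Sentence n) → ∑ (comps u) (λ J → δˢ J I) ≡ δᵂ u (flat I)
∑-comps-δ []      []      = refl
∑-comps-δ (a ∷ u) []      = trans (comps-first a u (λ J → δˢ J []))
  (σ-vanish u (λ x y → ∑-zero (comps y)))
∑-comps-δ []      (w ∷ I) = refl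
∑-comps-δ (a ∷ u) (w ∷ I) = begin
  ∑ (comps (a ∷ u)) (λ J → δˢ J (w ∷ I))
    ≡⟨ comps-first a u (λ J → δˢ J (w ∷ I)) ⟩
  σ u (λ x y → ∑ (comps y) (λ J → δˢ ((a ∷ x) ∷ J) (w ∷ I)))
    ≡⟨ σ-cong u (λ x y → trans
         (trans (∑-cong (comps y) (λ J → δᵂˢ-∷ (a ∷ x) (toW J) (toList w) (toW I)))
                (∑-*ˡ (comps y) (δᵂ (a ∷ x) (toList w)) (λ J → δˢ J I)))
         (cong (δᵂ (a ∷ x) (toList w) *_) (∑-comps-δ y I))) ⟩
  σ u (λ x y → δᵂ (a ∷ x) (toList w) * δᵂ y (flat I))
    ≡⟨ +-identityˡ _ ⟨
  0ℤ + σ u (λ x y → δᵂ (a ∷ x) (toList w) * δᵂ y (flat I))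
    ≡⟨ σ-∷ a u (λ x y → δᵂ x (toList w) * δᵂ y (flat I)) ⟨
  σ (a ∷ u) (λ x y → δᵂ x (toList w) * δᵂ y (flat I))
    ≡⟨ δᵂ-++ (a ∷ u) (toList w) (flat I) ⟩
  δᵂ (a ∷ u) (flat (w ∷ I))  ∎

size-flat : (I : Sentence n) → size I ≡ length (flat I)
size-flat []      = refl
size-flat (w ∷ I) = trans (cong (length⁺ w ℕ+_) (size-flat I)) (sym (length-++ (toList w)))

toList-injective : {v w : NWord n} → toList v ≡ toList w → v ≡ w
toList-injective {v = _ ∷ _} {_ ∷ _} refl = refl

toW-injective : {I J : Sentence n} → toW I ≡ toW J → I ≡ J
toW-injective {I = []}    {[]}    eq = refl
toW-injective {I = v ∷ I} {w ∷ J} eq =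
  cong₂ _∷_ (toList-injective (proj₁ (∷-injective eq))) (toW-injective (proj₂ (∷-injective eq)))

-- Every sentence of size `d` is listed exactly once. This evaluates both the sum that defines
-- `Mperp` and the sum over shapes in the theorem.
∑-sentencesOfSize-δ : (d : ℕ) (I : Sentence n) (G : Sentence n → ℤ) →
  ∑ (sentencesOfSize n d) (λ J → δˢ J I * G J) ≡ 𝟙 (size I ≟ℕ d) * G I
∑-sentencesOfSize-δ {n} d I G = begin
  ∑ (sentencesOfSize n d) (λ J → δˢ J I * G J)
    ≡⟨ ∑-cong (sentencesOfSize n d) (λ J → 𝟙-*-cong (toW J ≟ˢ toW I) (λ eq → cong G (toW-injective eq))) ⟩
  ∑ (sentencesOfSize n d) (λ J → δˢ J I * G I)
    ≡⟨ ∑-*ʳ (sentencesOfSize n d) (λ J → δˢ J I) (G I) ⟩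
  ∑ (sentencesOfSize n d) (λ J → δˢ J I) * G I
    ≡⟨ cong (_* G I) (trans (∑-concatMap comps (wordsOfLength n d) (λ J → δˢ J I))
         (trans (∑-cong (wordsOfLength n d) (λ u → ∑-comps-δ u I)) (∑-wordsOfLength-δ d (flat I)))) ⟩
  𝟙 (length (flat I) ≟ℕ d) * G I
    ≡⟨ cong (λ k → 𝟙 (k ≟ℕ d) * G I) (size-flat I) ⟨
  𝟙 (size I ≟ℕ d) * G I  ∎

size-dropEmpty : (m : WSent n) → size (dropEmpty m) ≡ length (concat m)
size-dropEmpty []            = refl
size-dropEmpty ([] ∷ m)      = size-dropEmpty m
size-dropEmpty ((a ∷ w) ∷ m) =
  cong suc (trans (cong (length w ℕ+_) (size-dropEmpty m)) (sym (length-++ w)))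

dropEmpty-toW : (I : Sentence n) → dropEmpty (toW I) ≡ I
dropEmpty-toW []            = refl
dropEmpty-toW ((a ∷ w) ∷ I) = cong ((a ∷ w) ∷_) (dropEmpty-toW I)

-- Both factors keep the number of words, empty ones included, which carries the inductions on
-- length. They share out the letters, which gives homogeneity.
record Factors (m m₁ m₂ : WSent n) : Set where
  field
    length₁ : length m₁ ≡ length m
    length₂ : length m₂ ≡ length m
    letters : length (concat m₁) ℕ+ length (concat m₂) ≡ length (concat m)

factorizations-Factors : (m : WSent n) → All (λ (m₁ , m₂) → Factors m m₁ m₂) (factorizations m)
factorizations-Factors []      = record { length₁ = refl ; length₂ = refl ; letters = refl } ∷ []
factorizations-Factors (w ∷ m) = subst (All _) (sym (factorizations-∷ w m)) (concat⁺ (map⁺ (All.map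
  (λ {(p , q)} eq → map⁺ (All.map (λ {(m₁ , m₂)} fs → record
    { length₁ = cong suc (Factors.length₁ fs)
    ; length₂ = cong suc (Factors.length₂ fs)
    ; letters = begin
        length (p ++ concat m₁) ℕ+ length (q ++ concat m₂)
          ≡⟨ cong₂ _ℕ+_ (length-++ p) (length-++ q) ⟩
        (length p ℕ+ length (concat m₁)) ℕ+ (length q ℕ+ length (concat m₂))
          ≡⟨ ℕ-interchange (length p) (length (concat m₁)) (length q) (length (concat m₂)) ⟩
        (length p ℕ+ length q) ℕ+ (length (concat m₁) ℕ+ length (concat m₂))
          ≡⟨ cong₂ _ℕ+_ (trans (sym (length-++ p)) (cong length eq)) (Factors.letters fs) ⟩
        length w ℕ+ length (concat m)
          ≡⟨ length-++ w ⟨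
        length (w ++ concat m)  ∎
    }) (factorizations-Factors m)))
  (splits-++ w))))
  where
  ℕ-interchange : ∀ a b c d → (a ℕ+ b) ℕ+ (c ℕ+ d) ≡ (a ℕ+ c) ℕ+ (b ℕ+ d)
  ℕ-interchange = ℕ-solve-∀

𝓕-cong-Factors : {G G′ : WSent n → WSent n → ℤ} (m : WSent n) →
  (∀ m₁ m₂ → Factors m m₁ m₂ → G m₁ m₂ ≡ G′ m₁ m₂) → 𝓕 m G ≡ 𝓕 m G′
𝓕-cong-Factors m eq = ∑-cong-All (factorizations-Factors m) (uncurry eq)

𝟙-absorb : {R : Set} (s : Dec R) (d : Dec P) (e : Dec Q) → (P → Q → R) → 𝟙 s * (𝟙 d * 𝟙 e) ≡ 𝟙 d * 𝟙 e
𝟙-absorb s (yes p) (yes q) f = trans (*-identityʳ (𝟙 s)) (𝟙-yes s (f p q))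
𝟙-absorb s (yes p) (no _)  f = *-zeroʳ (𝟙 s)
𝟙-absorb s (no _)  e       f = *-zeroʳ (𝟙 s)

-- The restriction of `Mperp` to size `size K + size S` loses nothing: in a nonzero term the two
-- factors of `I` have the sizes of `K` and `S`.
Mperp-H : (S I K : Sentence n) →
  Mperp S (H I) K ≡ 𝓕 (toW I) (λ m₁ m₂ → δˢ (dropEmpty m₁) K * δˢ (dropEmpty m₂) S)
Mperp-H {n} S I K = begin
  Mperp S (H I) K
    ≡⟨ ∑-sentencesOfSize-δ (size K ℕ+ size S) I (λ J → 𝓕 (toW J) (λ m₁ m₂ → δˢ (dropEmpty m₁) K * δˢ (dropEmpty m₂) S)) ⟩
  𝟙 s * 𝓕 (toW I) (λ m₁ m₂ → δˢ (dropEmpty m₁) K * δˢ (dropEmpty m₂) S)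
    ≡⟨ 𝓕-*ˡ (toW I) (𝟙 s) (λ m₁ m₂ → δˢ (dropEmpty m₁) K * δˢ (dropEmpty m₂) S) ⟨
  𝓕 (toW I) (λ m₁ m₂ → 𝟙 s * (δˢ (dropEmpty m₁) K * δˢ (dropEmpty m₂) S))
    ≡⟨ 𝓕-cong-Factors (toW I) (λ m₁ m₂ fs →
         𝟙-absorb s (toW (dropEmpty m₁) ≟ˢ toW K) (toW (dropEmpty m₂) ≟ˢ toW S) (λ eq₁ eq₂ → begin
           size I                                             ≡⟨ size-flat I ⟩
           length (flat I)                                    ≡⟨ Factors.letters fs ⟨
           length (concat m₁) ℕ+ length (concat m₂)           ≡⟨ cong₂ _ℕ+_ (size-dropEmpty m₁) (size-dropEmpty m₂) ⟨
           size (dropEmpty m₁) ℕ+ size (dropEmpty m₂)         ≡⟨ cong₂ (λ A B → size A ℕ+ size B) (toW-injective eq₁) (toW-injective eq₂) ⟩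
           size K ℕ+ size S                                   ∎)) ⟩
  𝓕 (toW I) (λ m₁ m₂ → δˢ (dropEmpty m₁) K * δˢ (dropEmpty m₂) S)  ∎
  where
  s = size I ≟ℕ (size K ℕ+ size S)

-- `inner []` is the identity by definition, but `innerH []` is a sum over factorizations;
-- `ε q [] ≡ 𝟘 q` leaves only the one that removes nothing.
innerH-emptyWord : (m : WSent n) (K : Sentence n) → innerH [] m K ≡ δˢ (dropEmpty m) K
innerH-emptyWord []      K = trans (innerH-[] [] K) (*-identityʳ (δˢ [] K))
innerH-emptyWord (w ∷ m) K = begin
  innerH [] (w ∷ m) K
    ≡⟨ innerH-∷ [] w m K ⟩
  σ w (λ p q → headCoeff p K * σ [] (λ u₁ u₂ → ε q u₂ * innerH u₁ m (dropHead p K)))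
    ≡⟨ σ-cong w (λ p q → trans
         (cong (headCoeff p K *_) (trans (σ-[] (λ u₁ u₂ → ε q u₂ * innerH u₁ m (dropHead p K)))
           (cong₂ _*_ (ε-[] q) (innerH-emptyWord m (dropHead p K)))))
         (shuffle (headCoeff p K) (𝟘 q) (δˢ (dropEmpty m) (dropHead p K)))) ⟩
  σ w (λ p q → headCoeff p K * δˢ (dropEmpty m) (dropHead p K) * 𝟘 q)
    ≡⟨ σ-𝟘ʳ w (λ p → headCoeff p K * δˢ (dropEmpty m) (dropHead p K)) ⟩
  headCoeff w K * δˢ (dropEmpty m) (dropHead w K)
    ≡⟨ δˢ-dropEmpty w m K ⟨
  δˢ (dropEmpty (w ∷ m)) K  ∎
  where
  shuffle : ∀ a b c → a * (b * c) ≡ a * c * b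
  shuffle = solve-∀

-- An empty word has only the trivial cut. The lemma links `inner`, which sees only `dropEmpty m`,
-- with the sums over weak sentences.
innerH-dropEmpty : (u : Word n) (m : WSent n) (K : Sentence n) →
  innerH u (toW (dropEmpty m)) K ≡ innerH u m K
innerH-dropEmpty u []            K = refl
innerH-dropEmpty u ([] ∷ m)      K = trans (innerH-dropEmpty u m K) (sym (trans
  (𝓕-∷ [] m (λ m₁ m₂ → δˢ (dropEmpty m₁) K * η u (dropEmpty m₂)))
  (σ-[] (λ p q → 𝓕 m (λ m₁ m₂ → δˢ (dropEmpty (p ∷ m₁)) K * η u (dropEmpty (q ∷ m₂)))))))
innerH-dropEmpty u ((a ∷ w) ∷ m) K = begin
  innerH u ((a ∷ w) ∷ toW (dropEmpty m)) K
    ≡⟨ innerH-∷ u (a ∷ w) (toW (dropEmpty m)) K ⟩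
  σ (a ∷ w) (λ p q → headCoeff p K * σ u (λ u₁ u₂ → ε q u₂ * innerH u₁ (toW (dropEmpty m)) (dropHead p K)))
    ≡⟨ σ-cong (a ∷ w) (λ p q → cong (headCoeff p K *_) (σ-cong u (λ u₁ u₂ →
         cong (ε q u₂ *_) (innerH-dropEmpty u₁ m (dropHead p K))))) ⟩
  σ (a ∷ w) (λ p q → headCoeff p K * σ u (λ u₁ u₂ → ε q u₂ * innerH u₁ m (dropHead p K)))
    ≡⟨ innerH-∷ u (a ∷ w) m K ⟨
  innerH u ((a ∷ w) ∷ m) K  ∎

inner-H : (u : Word n) (m : WSent n) (K : Sentence n) → inner u (H (dropEmpty m)) K ≡ innerH u m K
inner-H []      m K = trans (δᵂˢ-sym (toW K) (toW (dropEmpty m))) (sym (innerH-emptyWord m K))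
inner-H {n} (a ∷ u) m K = trans (begin
  inner (a ∷ u) (H I) K
    ≡⟨ ∑-map reverse (comps (a ∷ u)) (λ Q → sgn Q * ∑ (coarsen Q) (λ S → Mperp S (H I) K)) ⟩
  ∑ (comps (a ∷ u)) (λ Q → sgn (reverse Q) * ∑ (coarsen (reverse Q)) (λ S → Mperp S (H I) K))
    ≡⟨ ∑-cong (comps (a ∷ u)) (λ Q → cong₂ _*_ (cong sign (length-reverse Q)) (begin
      ∑ (coarsen (reverse Q)) (λ S → Mperp S (H I) K)
        ≡⟨ ∑-cong (coarsen (reverse Q)) (λ S → trans (Mperp-H S I K)
             (𝓕-cong (toW I) (λ m₁ m₂ → cong (δˢ (dropEmpty m₁) K *_) (δᵂˢ-sym (toW (dropEmpty m₂)) (toW S))))) ⟩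
      ∑ (coarsen (reverse Q)) (λ S → 𝓕 (toW I) (λ m₁ m₂ → δˢ (dropEmpty m₁) K * δˢ S (dropEmpty m₂)))
        ≡⟨ ∑-swap (coarsen (reverse Q)) (factorizations (toW I)) (λ S (m₁ , m₂) → δˢ (dropEmpty m₁) K * δˢ S (dropEmpty m₂)) ⟩
      𝓕 (toW I) (λ m₁ m₂ → ∑ (coarsen (reverse Q)) (λ S → δˢ (dropEmpty m₁) K * δˢ S (dropEmpty m₂)))
        ≡⟨ 𝓕-cong (toW I) (λ m₁ m₂ → ∑-*ˡ (coarsen (reverse Q)) (δˢ (dropEmpty m₁) K) (λ S → δˢ S (dropEmpty m₂))) ⟩
      𝓕 (toW I) (λ m₁ m₂ → δˢ (dropEmpty m₁) K * #coarsen (reverse Q) (dropEmpty m₂))  ∎)) ⟩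
  ∑ (comps (a ∷ u)) (λ Q → sgn Q * 𝓕 (toW I) (λ m₁ m₂ → δˢ (dropEmpty m₁) K * #coarsen (reverse Q) (dropEmpty m₂)))
    ≡⟨ ∑-cong (comps (a ∷ u)) (λ Q → trans
         (sym (𝓕-*ˡ (toW I) (sgn Q) (λ m₁ m₂ → δˢ (dropEmpty m₁) K * #coarsen (reverse Q) (dropEmpty m₂))))
         (𝓕-cong (toW I) (λ m₁ m₂ → shuffle (sgn Q) (δˢ (dropEmpty m₁) K) (#coarsen (reverse Q) (dropEmpty m₂))))) ⟩
  ∑ (comps (a ∷ u)) (λ Q → 𝓕 (toW I) (λ m₁ m₂ → δˢ (dropEmpty m₁) K * (sgn Q * #coarsen (reverse Q) (dropEmpty m₂))))
    ≡⟨ ∑-swap (comps (a ∷ u)) (factorizations (toW I))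
         (λ Q (m₁ , m₂) → δˢ (dropEmpty m₁) K * (sgn Q * #coarsen (reverse Q) (dropEmpty m₂))) ⟩
  𝓕 (toW I) (λ m₁ m₂ → ∑ (comps (a ∷ u)) (λ Q → δˢ (dropEmpty m₁) K * (sgn Q * #coarsen (reverse Q) (dropEmpty m₂))))
    ≡⟨ 𝓕-cong (toW I) (λ m₁ m₂ → ∑-*ˡ (comps (a ∷ u)) (δˢ (dropEmpty m₁) K)
         (λ Q → sgn Q * #coarsen (reverse Q) (dropEmpty m₂))) ⟩
  innerH (a ∷ u) (toW I) K  ∎) (innerH-dropEmpty (a ∷ u) m K)
  where
  I : Sentence n
  I = dropEmpty m
  shuffle : ∀ a b c → a * (b * c) ≡ b * (a * c)
  shuffle = solve-∀

-- At most one cut of `x` has left half `v`, so the partial function becomes a sum over cuts, to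
-- which `δᵂ-++` and `σ-assoc` apply.
stripPrefix-σ : (v x : Word n) (G : Word n → ℤ) →
  maybe′ G 0ℤ (stripPrefix v x) ≡ σ x (λ s u → δᵂ s v * G u)
stripPrefix-σ []      x       G = sym (trans (σ-cong x (λ s u → cong (_* G u) (δᵂ-[] s))) (σ-𝟘ˡ x G))
stripPrefix-σ (a ∷ v) []      G = refl
stripPrefix-σ (a ∷ v) (b ∷ x) G = begin
  maybe′ G 0ℤ (if does (a ≟F b) then stripPrefix v x else nothing)
    ≡⟨ branch ⟩
  𝟙 (a ≟F b) * σ x (λ s u → δᵂ s v * G u)
    ≡⟨ cong (_* σ x (λ s u → δᵂ s v * G u)) (𝟙-⇔ (a ≟F b) (b ≟F a) sym sym) ⟩
  𝟙 (b ≟F a) * σ x (λ s u → δᵂ s v * G u)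
    ≡⟨ σ-*ˡ x (𝟙 (b ≟F a)) (λ s u → δᵂ s v * G u) ⟨
  σ x (λ s u → 𝟙 (b ≟F a) * (δᵂ s v * G u))
    ≡⟨ σ-cong x (λ s u → trans (cong (_* G u) (Delta.δ-∷ _≟F_ b s a v)) (*-assoc (𝟙 (b ≟F a)) (δᵂ s v) (G u))) ⟨
  σ x (λ s u → δᵂ (b ∷ s) (a ∷ v) * G u)
    ≡⟨ +-identityˡ _ ⟨
  0ℤ + σ x (λ s u → δᵂ (b ∷ s) (a ∷ v) * G u)
    ≡⟨ σ-∷ b x (λ s u → δᵂ s (a ∷ v) * G u) ⟨
  σ (b ∷ x) (λ s u → δᵂ s (a ∷ v) * G u)  ∎
  where
  branch : maybe′ G 0ℤ (if does (a ≟F b) then stripPrefix v x else nothing) ≡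
    𝟙 (a ≟F b) * σ x (λ s u → δᵂ s v * G u)
  branch with does (a ≟F b)
  ... | true  = trans (stripPrefix-σ v x G) (sym (*-identityˡ _))
  ... | false = refl

𝔹-∷ : (v : NWord n) (f : NSym n) (x : NWord n) (K : Sentence n) →
  𝔹 v f (x ∷ K) ≡ σ (toList x) (λ s u → δᵂ s (toList v) * inner u f K)
𝔹-∷ v f x K with stripPrefix (toList v) (toList x) | stripPrefix-σ (toList v) (toList x) (λ u → inner u f K)
... | nothing | eq = eq
... | just u  | eq = eq

-- Linearity, with `f` given as a sum coefficient by coefficient; `inner` and `𝔹` inherit it in the
-- same form.
Mperp-∑ : {f : NSym n} (xs : List X) (g : X → NSym n) → (∀ K → f K ≡ ∑ xs (λ x → g x K)) →
  ∀ S K → Mperp S f K ≡ ∑ xs (λ x → Mperp S (g x) K)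
Mperp-∑ {n = n} {f = f} xs g eq S K = begin
  ∑ Is (λ I → f I * c I)
    ≡⟨ ∑-cong Is (λ I → trans (cong (_* c I) (eq I)) (sym (∑-*ʳ xs (λ x → g x I) (c I)))) ⟩
  ∑ Is (λ I → ∑ xs (λ x → g x I * c I))
    ≡⟨ ∑-swap Is xs (λ I x → g x I * c I) ⟩
  ∑ xs (λ x → ∑ Is (λ I → g x I * c I))  ∎
  where
  Is = sentencesOfSize n (size K ℕ+ size S)
  c : Sentence n → ℤ
  c I = pair I (M K *ps M S)

inner-∑ : {f : NSym n} (xs : List X) (g : X → NSym n) → (∀ K → f K ≡ ∑ xs (λ x → g x K)) →
  ∀ u K → inner u f K ≡ ∑ xs (λ x → inner u (g x) K)
inner-∑ xs g eq []      K = eq K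
inner-∑ {f = f} xs g eq (a ∷ u) K = begin
  ∑ Qs (λ Q → sgn Q * ∑ (coarsen Q) (λ S → Mperp S f K))
    ≡⟨ ∑-cong Qs (λ Q → trans
         (cong (sgn Q *_) (trans (∑-cong (coarsen Q) (λ S → Mperp-∑ xs g eq S K))
                                 (∑-swap (coarsen Q) xs (λ S x → Mperp S (g x) K))))
         (sym (∑-*ˡ xs (sgn Q) (λ x → ∑ (coarsen Q) (λ S → Mperp S (g x) K))))) ⟩
  ∑ Qs (λ Q → ∑ xs (λ x → sgn Q * ∑ (coarsen Q) (λ S → Mperp S (g x) K)))
    ≡⟨ ∑-swap Qs xs (λ Q x → sgn Q * ∑ (coarsen Q) (λ S → Mperp S (g x) K)) ⟩
  ∑ xs (λ x → inner (a ∷ u) (g x) K)  ∎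
  where
  Qs = map reverse (comps (a ∷ u))

𝔹-∑ : {f : NSym n} (xs : List X) (g : X → NSym n) → (∀ K → f K ≡ ∑ xs (λ x → g x K)) →
  ∀ v K → 𝔹 v f K ≡ ∑ xs (λ x → 𝔹 v (g x) K)
𝔹-∑ xs g eq v []      = sym (∑-zero xs)
𝔹-∑ {f = f} xs g eq v (y ∷ K) = begin
  𝔹 v f (y ∷ K)
    ≡⟨ 𝔹-∷ v f y K ⟩
  σ (toList y) (λ s u → δᵂ s (toList v) * inner u f K)
    ≡⟨ σ-cong (toList y) (λ s u → trans (cong (δᵂ s (toList v) *_) (inner-∑ xs g eq u K))
         (sym (∑-*ˡ xs (δᵂ s (toList v)) (λ x → inner u (g x) K)))) ⟩
  σ (toList y) (λ s u → ∑ xs (λ x → δᵂ s (toList v) * inner u (g x) K))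
    ≡⟨ σ-swap (toList y) xs (λ s u x → δᵂ s (toList v) * inner u (g x) K) ⟩
  ∑ xs (λ x → σ (toList y) (λ s u → δᵂ s (toList v) * inner u (g x) K))
    ≡⟨ ∑-cong xs (λ x → sym (𝔹-∷ v (g x) y K)) ⟩
  ∑ xs (λ x → 𝔹 v (g x) (y ∷ K))  ∎

-- `𝔹` strips `w` followed by `t₁ = concat m₂` from `x` and leaves `u`. For fixed `t = t₁ ++ u` the
-- sum over factorizations is `Γ t m K`, so only `t = []` remains, that is, `x = w`.
H-expansion : (w : NWord n) (m : WSent n) (K : Sentence n) →
  H (w ∷ dropEmpty m) K ≡ 𝓕 m (λ m₁ m₂ → 𝔹 (w ⁺++ concat m₂) (H (dropEmpty m₁)) K)
H-expansion w m []      = sym (∑-zero (factorizations m))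
H-expansion w m (x ∷ K) = sym (begin
  𝓕 m (λ m₁ m₂ → 𝔹 (w ⁺++ concat m₂) (H (dropEmpty m₁)) (x ∷ K))
    ≡⟨ 𝓕-cong m expand ⟩
  𝓕 m (λ m₁ m₂ → σ x′ (λ s t → δᵂ s w′ * σ t (λ t₁ u → δᵂ t₁ (concat m₂) * innerH u m₁ K)))
    ≡⟨ 𝓕-σ-swap m x′ (λ m₁ m₂ s t → δᵂ s w′ * σ t (λ t₁ u → δᵂ t₁ (concat m₂) * innerH u m₁ K)) ⟩
  σ x′ (λ s t → 𝓕 m (λ m₁ m₂ → δᵂ s w′ * σ t (λ t₁ u → δᵂ t₁ (concat m₂) * innerH u m₁ K)))
    ≡⟨ σ-cong x′ (λ s t → trans
         (𝓕-*ˡ m (δᵂ s w′) (λ m₁ m₂ → σ t (λ t₁ u → δᵂ t₁ (concat m₂) * innerH u m₁ K)))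
         (cong (δᵂ s w′ *_) (Γ-collapse t m K))) ⟩
  σ x′ (λ s t → δᵂ s w′ * (𝟘 t * δˢ (dropEmpty m) K))
    ≡⟨ σ-cong x′ (λ s t → shuffle (δᵂ s w′) (𝟘 t) (δˢ (dropEmpty m) K)) ⟩
  σ x′ (λ s t → δᵂ s w′ * δˢ (dropEmpty m) K * 𝟘 t)
    ≡⟨ σ-𝟘ʳ x′ (λ s → δᵂ s w′ * δˢ (dropEmpty m) K) ⟩
  δᵂ x′ w′ * δˢ (dropEmpty m) K
    ≡⟨ cong (δᵂ x′ w′ *_) (δᵂˢ-sym (toW (dropEmpty m)) (toW K)) ⟩
  δᵂ x′ w′ * δˢ K (dropEmpty m)
    ≡⟨ δᵂˢ-∷ x′ (toW K) w′ (toW (dropEmpty m)) ⟨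
  δˢ (x ∷ K) (w ∷ dropEmpty m)  ∎)
  where
  x′ = toList x
  w′ = toList w
  shuffle : ∀ a b c → a * (b * c) ≡ a * c * b
  shuffle = solve-∀
  expand : ∀ m₁ m₂ → 𝔹 (w ⁺++ concat m₂) (H (dropEmpty m₁)) (x ∷ K) ≡
    σ x′ (λ s t → δᵂ s w′ * σ t (λ t₁ u → δᵂ t₁ (concat m₂) * innerH u m₁ K))
  expand m₁ m₂ = begin
    𝔹 (w ⁺++ concat m₂) (H (dropEmpty m₁)) (x ∷ K)
      ≡⟨ 𝔹-∷ (w ⁺++ concat m₂) (H (dropEmpty m₁)) x K ⟩
    σ x′ (λ s u → δᵂ s (w′ ++ concat m₂) * inner u (H (dropEmpty m₁)) K)
      ≡⟨ σ-cong x′ (λ s u → trans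
           (cong₂ _*_ (sym (δᵂ-++ s w′ (concat m₂))) (inner-H u m₁ K))
           (sym (σ-*ʳ s (λ s₁ t₁ → δᵂ s₁ w′ * δᵂ t₁ (concat m₂)) (innerH u m₁ K)))) ⟩
    σ x′ (λ s u → σ s (λ s₁ t₁ → δᵂ s₁ w′ * δᵂ t₁ (concat m₂) * innerH u m₁ K))
      ≡⟨ σ-assoc x′ (λ s₁ t₁ u → δᵂ s₁ w′ * δᵂ t₁ (concat m₂) * innerH u m₁ K) ⟩
    σ x′ (λ s₁ t → σ t (λ t₁ u → δᵂ s₁ w′ * δᵂ t₁ (concat m₂) * innerH u m₁ K))
      ≡⟨ σ-cong x′ (λ s₁ t → trans
           (σ-cong t (λ t₁ u → *-assoc (δᵂ s₁ w′) (δᵂ t₁ (concat m₂)) (innerH u m₁ K)))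
           (σ-*ˡ t (δᵂ s₁ w′) (λ t₁ u → δᵂ t₁ (concat m₂) * innerH u m₁ K))) ⟩
    σ x′ (λ s t → δᵂ s w′ * σ t (λ t₁ u → δᵂ t₁ (concat m₂) * innerH u m₁ K))  ∎

-- Rows of tableaux

open Delta _≟ℕ_ using () renaming (_≟ᴸ_ to _≟ᴿ_; δ to δᴿ; δ-∷ to δᴿ-∷)

InRange : ℕ → List ℕ → Set
InRange L = All (λ i → 1 ≤ i × i ≤ L)

rowsOf-property : (L k : ℕ) → All (λ r → length r ≡ k × InRange L r) (rowsOf L k)
rowsOf-property L zero    = (refl , []) ∷ []
rowsOf-property L (suc k) = concat⁺ (map⁺ (applyUpTo⁺₁ suc L λ i<L →
  map⁺ (All.map (λ (len , rng) → cong suc len , (s≤s z≤n , i<L) ∷ rng) (rowsOf-property L k))))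

∑-upTo-suc : (L : ℕ) (f : ℕ → ℤ) → ∑ (applyUpTo suc L) f ≡ ∑ (upTo L) (f ∘ suc)
∑-upTo-suc L f = trans (cong (λ xs → ∑ xs f) (sym (map-upTo suc L))) (∑-map suc (upTo L) f)

∑-upTo-𝟙 : {L x : ℕ} → x < L → ∑ (upTo L) (λ i → 𝟙 (i ≟ℕ x)) ≡ 1ℤ
∑-upTo-𝟙 {suc L} {zero}  (s≤s x<L) =
  cong (1ℤ +_) (trans (∑-upTo-suc L (λ i → 𝟙 (i ≟ℕ 0))) (∑-zero (upTo L)))
∑-upTo-𝟙 {suc L} {suc x} (s≤s x<L) =
  trans (+-identityˡ _) (trans (∑-upTo-suc L (λ i → 𝟙 (i ≟ℕ suc x))) (∑-upTo-𝟙 x<L))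

∑-rowsOf-δ : {L : ℕ} {x : List ℕ} → InRange L x → ∑ (rowsOf L (length x)) (λ r → δᴿ r x) ≡ 1ℤ
∑-rowsOf-δ []                              = refl
∑-rowsOf-δ {L} {suc i ∷ x} ((s≤s _ , i<L) ∷ rng) = begin
  ∑ (rowsOf L (suc (length x))) (λ r → δᴿ r (suc i ∷ x))
    ≡⟨ ∑-concatMap (λ j → map (j ∷_) rows) (applyUpTo suc L) (λ r → δᴿ r (suc i ∷ x)) ⟩
  ∑ (applyUpTo suc L) (λ j → ∑ (map (j ∷_) rows) (λ r → δᴿ r (suc i ∷ x)))
    ≡⟨ ∑-cong (applyUpTo suc L) (λ j → begin
      ∑ (map (j ∷_) rows) (λ r → δᴿ r (suc i ∷ x))
        ≡⟨ ∑-map (j ∷_) rows (λ r → δᴿ r (suc i ∷ x)) ⟩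
      ∑ rows (λ r → δᴿ (j ∷ r) (suc i ∷ x))
        ≡⟨ ∑-cong rows (λ r → δᴿ-∷ j r (suc i) x) ⟩
      ∑ rows (λ r → 𝟙 (j ≟ℕ suc i) * δᴿ r x)
        ≡⟨ ∑-*ˡ rows (𝟙 (j ≟ℕ suc i)) (λ r → δᴿ r x) ⟩
      𝟙 (j ≟ℕ suc i) * ∑ rows (λ r → δᴿ r x)
        ≡⟨ trans (cong (𝟙 (j ≟ℕ suc i) *_) (∑-rowsOf-δ rng)) (*-identityʳ _) ⟩
      𝟙 (j ≟ℕ suc i)  ∎) ⟩
  ∑ (applyUpTo suc L) (λ j → 𝟙 (j ≟ℕ suc i))
    ≡⟨ trans (∑-upTo-suc L (λ j → 𝟙 (j ≟ℕ suc i))) (∑-upTo-𝟙 i<L) ⟩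
  1ℤ  ∎
  where
  rows = rowsOf L (length x)

rowType : Word n → List ℕ → ℕ → WSent n
rowType v r L = map (λ i → colorsWith i v r) (applyUpTo suc L)

-- The weakly increasing row in which i occurs as often as the i-th word of m has letters.
fill : WSent n → List ℕ
fill []      = []
fill (w ∷ m) = replicate (length w) 1 ++ map suc (fill m)

fill-InRange : (m : WSent n) → InRange (length m) (fill m)
fill-InRange []      = []
fill-InRange (w ∷ m) = ++⁺ (replicate⁺ (length w) (s≤s z≤n , s≤s z≤n))
  (map⁺ (All.map (λ (_ , i≤) → s≤s z≤n , s≤s i≤) (fill-InRange m)))

length-fill : (m : WSent n) → length (fill m) ≡ length (concat m)
length-fill []      = refl
length-fill (w ∷ m) = begin
  length (replicate (length w) 1 ++ map suc (fill m))
    ≡⟨ length-++ (replicate (length w) 1) ⟩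
  length (replicate (length w) 1) ℕ+ length (map suc (fill m))
    ≡⟨ cong₂ _ℕ+_ (length-replicate (length w)) (trans (length-map suc (fill m)) (length-fill m)) ⟩
  length w ℕ+ length (concat m)
    ≡⟨ length-++ w ⟨
  length (w ++ concat m)  ∎

weaklyInc-map-suc : (r : List ℕ) → weaklyInc (map suc r) ≡ weaklyInc r
weaklyInc-map-suc []               = refl
weaklyInc-map-suc (x ∷ [])         = refl
weaklyInc-map-suc (zero  ∷ y ∷ r)  = weaklyInc-map-suc (y ∷ r)
weaklyInc-map-suc (suc x ∷ y ∷ r)  = cong ((x <ᵇ y) ∧_) (weaklyInc-map-suc (y ∷ r))

weaklyInc-replicate-1 : (k : ℕ) (r : List ℕ) →
  weaklyInc (replicate k 1 ++ map suc r) ≡ weaklyInc r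
weaklyInc-replicate-1 zero          r       = weaklyInc-map-suc r
weaklyInc-replicate-1 (suc zero)    []      = refl
weaklyInc-replicate-1 (suc zero)    (x ∷ r) = weaklyInc-map-suc (x ∷ r)
weaklyInc-replicate-1 (suc (suc k)) r       = weaklyInc-replicate-1 (suc k) r

weaklyInc-fill : (m : WSent n) → weaklyInc (fill m) ≡ true
weaklyInc-fill []      = refl
weaklyInc-fill (w ∷ m) = trans (weaklyInc-replicate-1 (length w) (fill m)) (weaklyInc-fill m)

colorsWith-1 : (w v : Word n) {L : ℕ} {r : List ℕ} → InRange L r →
  colorsWith 1 (w ++ v) (replicate (length w) 1 ++ map suc r) ≡ w
colorsWith-1 (c ∷ w) v       rng                    = cong (c ∷_) (colorsWith-1 w v rng)
colorsWith-1 []      []      rng                    = refl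
colorsWith-1 []      (c ∷ v) []                     = refl
colorsWith-1 []      (c ∷ v) ((s≤s _ , _) ∷ rng)    = colorsWith-1 [] v rng

colorsWith-suc : (w v : Word n) (i : ℕ) (r : List ℕ) →
  colorsWith (suc (suc i)) (w ++ v) (replicate (length w) 1 ++ map suc r) ≡ colorsWith (suc i) v r
colorsWith-suc (c ∷ w) v       i r       = colorsWith-suc w v i r
colorsWith-suc []      []      i r       = refl
colorsWith-suc []      (c ∷ v) i []      = refl
colorsWith-suc []      (c ∷ v) i (x ∷ r) with x ≡ᵇ suc i
... | true  = cong (c ∷_) (colorsWith-suc [] v i r)
... | false = colorsWith-suc [] v i r

applyUpTo-cong : {A : Set} {f g : ℕ → A} → (∀ i → f i ≡ g i) → ∀ L → applyUpTo f L ≡ applyUpTo g L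
applyUpTo-cong eq zero    = refl
applyUpTo-cong eq (suc L) = cong₂ _∷_ (eq 0) (applyUpTo-cong (eq ∘ suc) L)

rowType-replicate-1 : (w v : Word n) (L : ℕ) {r : List ℕ} → InRange L r →
  rowType (w ++ v) (replicate (length w) 1 ++ map suc r) (suc L) ≡ w ∷ rowType v r L
rowType-replicate-1 w v L {r} rng = cong₂ _∷_ (colorsWith-1 w v rng) (begin
  map (λ i → colorsWith i (w ++ v) r⁺) (applyUpTo (suc ∘ suc) L)
    ≡⟨ map-applyUpTo (suc ∘ suc) (λ i → colorsWith i (w ++ v) r⁺) L ⟩
  applyUpTo (λ i → colorsWith (suc (suc i)) (w ++ v) r⁺) L
    ≡⟨ applyUpTo-cong (λ i → colorsWith-suc w v i r) L ⟩
  applyUpTo (λ i → colorsWith (suc i) v r) L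
    ≡⟨ map-applyUpTo suc (λ i → colorsWith i v r) L ⟨
  rowType v r L  ∎)
  where
  r⁺ = replicate (length w) 1 ++ map suc r

rowType-fill : (m : WSent n) → rowType (concat m) (fill m) (length m) ≡ m
rowType-fill []      = refl
rowType-fill (w ∷ m) = trans
  (rowType-replicate-1 w (concat m) (length m) (fill-InRange m)) (cong (w ∷_) (rowType-fill m))

∧-true : ∀ {b c} → b ∧ c ≡ true → b ≡ true × c ≡ true
∧-true {true} eq = refl , eq

≤ᵇ-true : ∀ x y → (x ≤ᵇ y) ≡ true → x ≤ y
≤ᵇ-true x y eq = ℕₚ.≤ᵇ⇒≤ x y (subst T (sym eq) tt)

weaklyInc-tail : ∀ x r → weaklyInc (x ∷ r) ≡ true → weaklyInc r ≡ true
weaklyInc-tail x []      eq = refl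
weaklyInc-tail x (y ∷ r) eq = proj₂ (∧-true {x ≤ᵇ y} eq)

-- Weak increase keeps every entry at least 2 once the first one is, so 1 can be subtracted
-- throughout.
unshift : ∀ {L} x r → weaklyInc (suc (suc x) ∷ r) ≡ true → InRange (suc L) (suc (suc x) ∷ r) →
  ∃[ r′ ] suc (suc x) ∷ r ≡ map suc r′ × InRange L r′
unshift x []      inc ((_ , s≤s le) ∷ []) = suc x ∷ [] , refl , (s≤s z≤n , le) ∷ []
unshift x (y ∷ r) inc ((_ , s≤s le) ∷ rng) with ≤ᵇ-true _ y (proj₁ (∧-true {suc (suc x) ≤ᵇ y} inc))
unshift x (suc (suc y) ∷ r) inc ((_ , s≤s le) ∷ rng) | s≤s (s≤s _)
  with unshift y r (weaklyInc-tail (suc (suc x)) (suc (suc y) ∷ r) inc) rng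
... | r′ , eq , rng′ = suc x ∷ r′ , cong (suc (suc x) ∷_) eq , (s≤s z≤n , le) ∷ rng′

-- The entries 1 of a weakly increasing row form an initial segment, colored by `w`; lowering the
-- rest gives `r′`. This drives the induction on the largest allowed entry.
record Peeled (L : ℕ) (v : Word n) (r : List ℕ) : Set where
  field
    {w v′}  : Word n
    {r′}    : List ℕ
    v≡      : v ≡ w ++ v′
    r≡      : r ≡ replicate (length w) 1 ++ map suc r′
    len     : length r′ ≡ length v′
    rng     : InRange L r′

peel : ∀ {L} (v : Word n) r → length r ≡ length v → weaklyInc r ≡ true → InRange (suc L) r → Peeled L v r
peel []      []       len inc rng = record { w = [] ; v′ = [] ; r′ = [] ; v≡ = refl ; r≡ = refl ; len = refl ; rng = [] }
peel (c ∷ v) (suc zero ∷ r) len inc (_ ∷ rng)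
  with peel v r (ℕₚ.suc-injective len) (weaklyInc-tail 1 r inc) rng
... | record { w = w ; v≡ = v≡ ; r≡ = r≡ ; len = len′ ; rng = rng′ } =
  record { w = c ∷ w ; v≡ = cong (c ∷_) v≡ ; r≡ = cong (1 ∷_) r≡ ; len = len′ ; rng = rng′ }
peel (c ∷ v) (suc (suc x) ∷ r) len inc rng with unshift x r inc rng
... | r′ , eq , rng′ = record
  { w = [] ; v′ = c ∷ v ; r′ = r′ ; v≡ = refl ; r≡ = eq
  ; len = trans (sym (trans (cong length eq) (length-map suc r′))) len ; rng = rng′ }

-- Together with `rowType-fill` this is a bijection between the weakly increasing rows colored by
-- `v` with entries up to `L` and the ways to cut `v` into `L` possibly empty words.
fill-rowType : ∀ L (v : Word n) r → length r ≡ length v → weaklyInc r ≡ true → InRange L r →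
  concat (rowType v r L) ≡ v × fill (rowType v r L) ≡ r
fill-rowType zero    []      []       len inc rng = refl , refl
fill-rowType zero    v       (x ∷ r)  len inc ((s≤s _ , ()) ∷ rng)
fill-rowType (suc L) v       r        len inc rng with peel v r len inc rng
... | record { w = w ; v′ = v′ ; r′ = r′ ; v≡ = refl ; r≡ = refl ; len = len′ ; rng = rng′ }
  with fill-rowType L v′ r′ len′ (trans (sym (weaklyInc-replicate-1 (length w) r′)) inc) rng′
... | eq₁ , eq₂ =
  trans (cong concat shape) (cong (w ++_) eq₁) ,
  trans (cong fill shape) (cong (λ s → replicate (length w) 1 ++ map suc s) eq₂)
  where
  shape : rowType (w ++ v′) (replicate (length w) 1 ++ map suc r′) (suc L) ≡ w ∷ rowType v′ r′ L
  shape = rowType-replicate-1 w v′ L rng′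

ι-𝟙 : ∀ b → ι b ≡ 𝟙 (b ≟ᴮ true)
ι-𝟙 true  = refl
ι-𝟙 false = refl

-- `fill m` is the only weakly increasing row of type `m`, and it fits the colors `v` exactly when
-- `concat m` is `v`. This eliminates the sum over the fillings of one row.
∑-rowsOf-rowType : ∀ {L} (v : Word n) (m : WSent n) → length m ≡ L → (G : List ℕ → ℤ) →
  ∑ (rowsOf L (length v)) (λ r → ι (weaklyInc r) * (δᵂˢ (rowType v r L) m * G r)) ≡
  δᵂ (concat m) v * G (fill m)
∑-rowsOf-rowType v m refl G = begin
  ∑ rows (λ r → ι (weaklyInc r) * (δᵂˢ (rowType v r L) m * G r))
    ≡⟨ ∑-cong-All (rowsOf-property L (length v)) (λ r (len , rng) → trans
         (sym (*-assoc (ι (weaklyInc r)) (δᵂˢ (rowType v r L) m) (G r)))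
         (trans (cong (_* G r) (unique r len rng)) (*-assoc (δᵂ (concat m) v) (δᴿ r (fill m)) (G r)))) ⟩
  ∑ rows (λ r → δᵂ (concat m) v * (δᴿ r (fill m) * G r))
    ≡⟨ ∑-*ˡ rows (δᵂ (concat m) v) (λ r → δᴿ r (fill m) * G r) ⟩
  δᵂ (concat m) v * ∑ rows (λ r → δᴿ r (fill m) * G r)
    ≡⟨ 𝟙-*-cong (concat m ≟ᵂ v) collapse ⟩
  δᵂ (concat m) v * G (fill m)  ∎
  where
  L = length m
  rows = rowsOf L (length v)
  unique : ∀ r → length r ≡ length v → InRange L r →
    ι (weaklyInc r) * δᵂˢ (rowType v r L) m ≡ δᵂ (concat m) v * δᴿ r (fill m)
  unique r len rng = trans (cong (_* δᵂˢ (rowType v r L) m) (ι-𝟙 (weaklyInc r))) (trans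
    (𝟙-× (weaklyInc r ≟ᴮ true) (rowType v r L ≟ˢ m) ((concat m ≟ᵂ v) ×-dec (r ≟ᴿ fill m)) to from)
    (sym (𝟙-× (concat m ≟ᵂ v) (r ≟ᴿ fill m) ((concat m ≟ᵂ v) ×-dec (r ≟ᴿ fill m)) _,_ (λ pq → pq))))
    where
    to : weaklyInc r ≡ true → rowType v r L ≡ m → concat m ≡ v × r ≡ fill m
    to inc eq with fill-rowType L v r len inc rng
    ... | eq₁ , eq₂ = trans (cong concat (sym eq)) eq₁ , trans (sym eq₂) (cong fill eq)
    from : concat m ≡ v × r ≡ fill m → weaklyInc r ≡ true × rowType v r L ≡ m
    from (refl , refl) = weaklyInc-fill m , rowType-fill m
  collapse : concat m ≡ v → ∑ rows (λ r → δᴿ r (fill m) * G r) ≡ G (fill m)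
  collapse refl = begin
    ∑ rows (λ r → δᴿ r (fill m) * G r)
      ≡⟨ ∑-cong rows (λ r → 𝟙-*-cong (r ≟ᴿ fill m) (cong G)) ⟩
    ∑ rows (λ r → δᴿ r (fill m) * G (fill m))
      ≡⟨ ∑-*ʳ rows (λ r → δᴿ r (fill m)) (G (fill m)) ⟩
    ∑ rows (λ r → δᴿ r (fill m)) * G (fill m)
      ≡⟨ cong (_* G (fill m)) (trans (cong (λ k → ∑ (rowsOf L k) (λ r → δᴿ r (fill m))) (sym (length-fill m)))
           (∑-rowsOf-δ (fill-InRange m))) ⟩
    1ℤ * G (fill m)
      ≡⟨ *-identityˡ (G (fill m)) ⟩
    G (fill m)  ∎

-- Counting immaculate tableaux

concat-map-∷ʳ : (f : X → List Y) (xs : List X) (x : X) → concat (map f (xs ++ x ∷ [])) ≡ concat (map f xs) ++ f x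
concat-map-∷ʳ f []       x = ++-identityʳ (f x)
concat-map-∷ʳ f (y ∷ xs) x = trans (cong (f y ++_) (concat-map-∷ʳ f xs x)) (sym (++-assoc (f y) (concat (map f xs)) (f x)))

zipWith-map-map : {A B C D : Set} (h : A → B → C) (f : D → A) (g : D → B) (xs : List D) →
  zipWith h (map f xs) (map g xs) ≡ map (λ x → h (f x) (g x)) xs
zipWith-map-map h f g []       = refl
zipWith-map-map h f g (x ∷ xs) = cong (h (f x) (g x) ∷_) (zipWith-map-map h f g xs)

-- Reading from the lowest row upwards puts the top row last, so it supplies a suffix of each word.
-- Hence the second factor of a factorization belongs to the top row.
typeOf-∷ : (v : NWord n) (J : Sentence n) (r : List ℕ) (T : List (List ℕ)) (L : ℕ) →
  typeOf (v ∷ J) (r ∷ T) L ≡ zipWith _++_ (typeOf J T L) (rowType (toList v) r L)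
typeOf-∷ v J r T L = trans (map-cong at (applyUpTo suc L))
  (sym (zipWith-map-map _++_ (λ i → concat (map (colors i) (reverse (zip (toW J) T))))
    (λ i → colorsWith i (toList v) r) (applyUpTo suc L)))
  where
  colors : ℕ → Word _ × List ℕ → Word _
  colors i (w , s) = colorsWith i w s
  at : ∀ i → concat (map (colors i) (reverse (zip (toW (v ∷ J)) (r ∷ T)))) ≡
    concat (map (colors i) (reverse (zip (toW J) T))) ++ colorsWith i (toList v) r
  at i = trans (cong (λ ps → concat (map (colors i) ps)) (unfold-reverse (toList v , r) (zip (toW J) T)))
    (concat-map-∷ʳ (colors i) (reverse (zip (toW J) T)) (toList v , r))

-- Each word of `m` is cut independently, by `δᵂ-++`. Equal lengths keep `zipWith` from truncating.
δᵂˢ-zipWith-++ : (A B m : WSent n) → length A ≡ length m → length B ≡ length m →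
  δᵂˢ (zipWith _++_ A B) m ≡ 𝓕 m (λ m₁ m₂ → δᵂˢ m₁ A * δᵂˢ m₂ B)
δᵂˢ-zipWith-++ []      []      []      lenA lenB = refl
δᵂˢ-zipWith-++ (a ∷ A) (b ∷ B) (w ∷ m) lenA lenB = sym (begin
  𝓕 (w ∷ m) (λ m₁ m₂ → δᵂˢ m₁ (a ∷ A) * δᵂˢ m₂ (b ∷ B))
    ≡⟨ 𝓕-∷ w m (λ m₁ m₂ → δᵂˢ m₁ (a ∷ A) * δᵂˢ m₂ (b ∷ B)) ⟩
  σ w (λ p q → 𝓕 m (λ m₁ m₂ → δᵂˢ (p ∷ m₁) (a ∷ A) * δᵂˢ (q ∷ m₂) (b ∷ B)))
    ≡⟨ σ-cong w (λ p q → trans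
         (𝓕-cong m (λ m₁ m₂ → trans (cong₂ _*_ (δᵂˢ-∷ p m₁ a A) (δᵂˢ-∷ q m₂ b B))
           (shuffle (δᵂ p a) (δᵂˢ m₁ A) (δᵂ q b) (δᵂˢ m₂ B))))
         (𝓕-*ˡ m (δᵂ p a * δᵂ q b) (λ m₁ m₂ → δᵂˢ m₁ A * δᵂˢ m₂ B))) ⟩
  σ w (λ p q → δᵂ p a * δᵂ q b * 𝓕 m (λ m₁ m₂ → δᵂˢ m₁ A * δᵂˢ m₂ B))
    ≡⟨ σ-*ʳ w (λ p q → δᵂ p a * δᵂ q b) (𝓕 m (λ m₁ m₂ → δᵂˢ m₁ A * δᵂˢ m₂ B)) ⟩
  σ w (λ p q → δᵂ p a * δᵂ q b) * 𝓕 m (λ m₁ m₂ → δᵂˢ m₁ A * δᵂˢ m₂ B)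
    ≡⟨ cong₂ _*_ (trans (δᵂ-++ w a b) (δᵂ-sym w (a ++ b)))
         (sym (δᵂˢ-zipWith-++ A B m (ℕₚ.suc-injective lenA) (ℕₚ.suc-injective lenB))) ⟩
  δᵂ (a ++ b) w * δᵂˢ (zipWith _++_ A B) m
    ≡⟨ δᵂˢ-∷ (a ++ b) (zipWith _++_ A B) w m ⟨
  δᵂˢ ((a ++ b) ∷ zipWith _++_ A B) (w ∷ m)  ∎)
  where
  shuffle : ∀ a b c d → (a * b) * (c * d) ≡ (a * c) * (b * d)
  shuffle = solve-∀

rowsInc : List (List ℕ) → Bool
rowsInc = foldr (λ r b → weaklyInc r ∧ b) true

-- Immaculate tableaux of shape J and type m whose first column stays strictly increasing below an entry b.
tableaux : ℕ → ℕ → Sentence n → WSent n → ℤ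
tableaux L b J m =
  ∑ (fillings J L) (λ T → ι (rowsInc T) * (ι (strictlyInc (b ∷ firstEntries T)) * δᵂˢ (typeOf J T L) m))

-- Position (from 1) of the first nonempty word; if there is none, one more than the length.
first : WSent n → ℕ
first []            = 1
first ([] ∷ m)      = suc (first m)
first ((_ ∷ _) ∷ m) = 1

head₀ : List ℕ → ℕ
head₀ []      = 0
head₀ (x ∷ _) = x

-- Each leading empty word is an entry missing from the row and raises the first entry by one.
head₀-fill : (m : WSent n) (a : Col n) (w : Word n) → concat m ≡ a ∷ w → head₀ (fill m) ≡ first m
head₀-fill ([] ∷ m)      a w eq = trans (head₀-map-suc (fill m) nonempty) (cong suc (head₀-fill m a w eq))
  where
  nonempty : ∃[ k ] length (fill m) ≡ suc k
  nonempty = length w , trans (length-fill m) (cong length eq)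
  head₀-map-suc : ∀ r → ∃[ k ] length r ≡ suc k → head₀ (map suc r) ≡ suc (head₀ r)
  head₀-map-suc (x ∷ r) _ = refl
head₀-fill ((_ ∷ _) ∷ m) a w eq = refl

-- `m₂` is the type of the top row and `m₁` that of the rows below, whose first column has to stay
-- above `first m₂`, the leading entry of the top row.
tableaux-∷ : ∀ {L} (b : ℕ) (v : NWord n) (J : Sentence n) (m : WSent n) → length m ≡ L →
  tableaux L b (v ∷ J) m ≡
  𝓕 m (λ m₁ m₂ → δᵂ (concat m₂) (toList v) * (ι (b <ᵇ first m₂) * tableaux L (first m₂) J m₁))
tableaux-∷ {n} {L} b v J m lenm = begin
  tableaux L b (v ∷ J) m
    ≡⟨ ∑-concatMap (λ r → map (r ∷_) Ts) rows weight ⟩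
  ∑ rows (λ r → ∑ (map (r ∷_) Ts) weight)
    ≡⟨ ∑-cong-All (rowsOf-property L (length⁺ v)) (λ r (len , _) → trans
         (∑-map (r ∷_) Ts weight)
         (trans (∑-cong Ts (λ T → term r T len)) (trans
           (∑-swap Ts (factorizations m) (λ T (m₁ , m₂) → summand r m₁ m₂ T))
           (𝓕-cong m (λ m₁ m₂ → collect r m₁ m₂))))) ⟩
  ∑ rows (λ r → 𝓕 m (byRow r))
    ≡⟨ ∑-swap rows (factorizations m) (λ r (m₁ , m₂) → byRow r m₁ m₂) ⟩
  𝓕 m (λ m₁ m₂ → ∑ rows (λ r → byRow r m₁ m₂))
    ≡⟨ 𝓕-cong-Factors m (λ m₁ m₂ fs → trans
         (∑-rowsOf-rowType (toList v) m₂ (trans (Factors.length₂ fs) lenm)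
           (λ r → ι (b <ᵇ head₀ r) * tableaux L (head₀ r) J m₁))
         (𝟙-*-cong (concat m₂ ≟ᵂ toList v) (λ eq →
           cong (λ k → ι (b <ᵇ k) * tableaux L k J m₁) (head₀-fill m₂ (List⁺.head v) (List⁺.tail v) eq)))) ⟩
  𝓕 m (λ m₁ m₂ → δᵂ (concat m₂) (toList v) * (ι (b <ᵇ first m₂) * tableaux L (first m₂) J m₁))  ∎
  where
  Ts = fillings J L
  rows = rowsOf L (length⁺ v)
  weight : List (List ℕ) → ℤ
  weight T = ι (rowsInc T) * (ι (strictlyInc (b ∷ firstEntries T)) * δᵂˢ (typeOf (v ∷ J) T L) m)
  byRow : List ℕ → WSent n → WSent n → ℤ
  byRow r m₁ m₂ =
    ι (weaklyInc r) * (δᵂˢ (rowType (toList v) r L) m₂ * (ι (b <ᵇ head₀ r) * tableaux L (head₀ r) J m₁))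
  summand : List ℕ → WSent n → WSent n → List (List ℕ) → ℤ
  summand r m₁ m₂ T =
    ι (weaklyInc r) * δᵂˢ (rowType (toList v) r L) m₂ * ι (b <ᵇ head₀ r) *
    (ι (rowsInc T) * (ι (strictlyInc (head₀ r ∷ firstEntries T)) * δᵂˢ (typeOf J T L) m₁))
  shuffle : ∀ w t b s a c → w * t * (b * s * (a * c)) ≡ w * c * b * (t * (s * a))
  shuffle = solve-∀
  length-types : (f : ℕ → Word n) → length (map f (applyUpTo suc L)) ≡ length m
  length-types f = trans (length-map f (applyUpTo suc L)) (trans (length-applyUpTo suc L) (sym lenm))
  term : ∀ r T → length r ≡ length⁺ v →
    ι (rowsInc (r ∷ T)) * (ι (strictlyInc (b ∷ firstEntries (r ∷ T))) * δᵂˢ (typeOf (v ∷ J) (r ∷ T) L) m) ≡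
    𝓕 m (λ m₁ m₂ → summand r m₁ m₂ T)
  term r@(x ∷ _) T len = begin
    ι (rowsInc (r ∷ T)) * (ι ((b <ᵇ x) ∧ strictlyInc (x ∷ firstEntries T)) * δᵂˢ (typeOf (v ∷ J) (r ∷ T) L) m)
      ≡⟨ cong₂ _*_ (ι-∧ (weaklyInc r) (rowsInc T)) (cong₂ _*_ (ι-∧ (b <ᵇ x) (strictlyInc (x ∷ firstEntries T)))
           (trans (cong (λ t → δᵂˢ t m) (typeOf-∷ v J r T L))
             (δᵂˢ-zipWith-++ (typeOf J T L) (rowType (toList v) r L) m (length-types _) (length-types _)))) ⟩
    W * B * (C * D * 𝓕 m (λ m₁ m₂ → δᵂˢ m₁ (typeOf J T L) * δᵂˢ m₂ (rowType (toList v) r L)))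
      ≡⟨ *-assoc (W * B) (C * D) _ ⟨
    W * B * (C * D) * 𝓕 m (λ m₁ m₂ → δᵂˢ m₁ (typeOf J T L) * δᵂˢ m₂ (rowType (toList v) r L))
      ≡⟨ 𝓕-*ˡ m (W * B * (C * D)) (λ m₁ m₂ → δᵂˢ m₁ (typeOf J T L) * δᵂˢ m₂ (rowType (toList v) r L)) ⟨
    𝓕 m (λ m₁ m₂ → W * B * (C * D) * (δᵂˢ m₁ (typeOf J T L) * δᵂˢ m₂ (rowType (toList v) r L)))
      ≡⟨ 𝓕-cong m (λ m₁ m₂ → trans
           (cong (W * B * (C * D) *_) (cong₂ _*_ (δᵂˢ-sym m₁ (typeOf J T L)) (δᵂˢ-sym m₂ (rowType (toList v) r L))))
           (trans (*-assoc (W * B) (C * D) _) (shuffle W B C D (δᵂˢ (typeOf J T L) m₁) (δᵂˢ (rowType (toList v) r L) m₂)))) ⟩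
    𝓕 m (λ m₁ m₂ → summand r m₁ m₂ T)  ∎
    where
    W = ι (weaklyInc r)
    B = ι (rowsInc T)
    C = ι (b <ᵇ x)
    D = ι (strictlyInc (x ∷ firstEntries T))
  collect : ∀ r m₁ m₂ → ∑ Ts (summand r m₁ m₂) ≡ byRow r m₁ m₂
  collect r m₁ m₂ = trans
    (∑-*ˡ Ts (W * C * B) (λ T → ι (rowsInc T) * (ι (strictlyInc (head₀ r ∷ firstEntries T)) * δᵂˢ (typeOf J T L) m₁)))
    (trans (*-assoc (W * C) B _) (*-assoc W C _))
    where
    W = ι (weaklyInc r)
    C = δᵂˢ (rowType (toList v) r L) m₂
    B = ι (b <ᵇ head₀ r)

κ : ℕ → Sentence n → WSent n → ℤ
κ b []      m = 𝟘 (concat m)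
κ b (v ∷ J) m = 𝓕 m (λ m₁ m₂ → δᵂ (concat m₂) (toList v) * (ι (b <ᵇ first m₂) * κ (first m₂) J m₁))

δᵂˢ-empties : (xs : List X) (m : WSent n) → length xs ≡ length m → δᵂˢ (map (λ _ → []) xs) m ≡ 𝟘 (concat m)
δᵂˢ-empties []       []            len = refl
δᵂˢ-empties (x ∷ xs) ([] ∷ m)      len = δᵂˢ-empties xs m (ℕₚ.suc-injective len)
δᵂˢ-empties (x ∷ xs) ((a ∷ w) ∷ m) len = refl

tableaux-κ : ∀ {L} (b : ℕ) (J : Sentence n) (m : WSent n) → length m ≡ L → tableaux L b J m ≡ κ b J m
tableaux-κ {L = L} b [] m len = begin
  1ℤ * (1ℤ * D) + 0ℤ  ≡⟨ trans (+-identityʳ (1ℤ * (1ℤ * D))) (trans (*-identityˡ (1ℤ * D)) (*-identityˡ D)) ⟩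
  D                   ≡⟨ δᵂˢ-empties (applyUpTo suc L) m (trans (length-applyUpTo suc L) (sym len)) ⟩
  𝟘 (concat m)        ∎
  where
  D = δᵂˢ (typeOf [] [] L) m
tableaux-κ b (v ∷ J) m len = trans (tableaux-∷ b v J m len) (𝓕-cong-Factors m (λ m₁ m₂ fs →
  cong (λ i → δᵂ (concat m₂) (toList v) * (ι (b <ᵇ first m₂) * i))
    (tableaux-κ (first m₂) J m₁ (trans (Factors.length₁ fs) len))))

-- Entries are at least 1, so a virtual 0 above the first column is harmless, and `Kostka` becomes
-- `tableaux` with `b = 0`.
strictlyInc-fillings : (J : Sentence n) (L : ℕ) →
  All (λ T → strictlyInc (firstEntries T) ≡ strictlyInc (0 ∷ firstEntries T)) (fillings J L)
strictlyInc-fillings []      L = refl ∷ []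
strictlyInc-fillings (v ∷ J) L = concat⁺ (map⁺ (All.map
  (λ {r} (len , rng) → map⁺ (All.universal (below r len rng) (fillings J L)))
  (rowsOf-property L (length⁺ v))))
  where
  below : ∀ r → length r ≡ length⁺ v → InRange L r → ∀ T →
    strictlyInc (firstEntries (r ∷ T)) ≡ strictlyInc (0 ∷ firstEntries (r ∷ T))
  below (_ ∷ _) len ((s≤s _ , _) ∷ _) T = refl

Kostka-κ : (J C : Sentence n) → pos (Kostka J C) ≡ κ 0 J (toW C)
Kostka-κ J C = begin
  pos (Kostka J C)
    ≡⟨ pos-countB _ (fillings J L) ⟩
  ∑ (fillings J L) (λ T → ι ((rowsInc T ∧ strictlyInc (firstEntries T)) ∧ wsentEq (typeOf J T L) (toW C)))
    ≡⟨ ∑-cong-All (strictlyInc-fillings J L) (λ T eq → trans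
         (ι-∧ (rowsInc T ∧ strictlyInc (firstEntries T)) (wsentEq (typeOf J T L) (toW C)))
         (trans (cong (_* δᵂˢ (typeOf J T L) (toW C)) (trans
             (ι-∧ (rowsInc T) (strictlyInc (firstEntries T)))
             (cong (λ b → ι (rowsInc T) * ι b) eq)))
           (*-assoc (ι (rowsInc T)) (ι (strictlyInc (0 ∷ firstEntries T))) (δᵂˢ (typeOf J T L) (toW C))))) ⟩
  tableaux L 0 J (toW C)
    ≡⟨ tableaux-κ 0 J (toW C) (length-map toList C) ⟩
  κ 0 J (toW C)  ∎
  where
  L = length C

-- Removing the smallest entry from a tableau

𝓕-[] : (m : WSent n) (G : WSent n → WSent n → ℤ) → 𝓕 ([] ∷ m) G ≡ 𝓕 m (λ m₁ m₂ → G ([] ∷ m₁) ([] ∷ m₂))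
𝓕-[] m G = trans (𝓕-∷ [] m G) (σ-[] (λ p q → 𝓕 m (λ m₁ m₂ → G (p ∷ m₁) (q ∷ m₂))))

-- If no box contains 1, all entries and the bound can be lowered by one.
κ-suc-[] : (b : ℕ) (J : Sentence n) (m : WSent n) → κ (suc b) J ([] ∷ m) ≡ κ b J m
κ-suc-[] b []      m = refl
κ-suc-[] b (v ∷ J) m = trans
  (𝓕-[] m (λ m₁ m₂ → δᵂ (concat m₂) (toList v) * (ι (suc b <ᵇ first m₂) * κ (first m₂) J m₁)))
  (𝓕-cong m (λ m₁ m₂ → cong (λ i → δᵂ (concat m₂) (toList v) * (ι (b <ᵇ first m₂) * i)) (κ-suc-[] (first m₂) J m₁)))

0<first : (m : WSent n) → (0 <ᵇ first m) ≡ true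
0<first []            = refl
0<first ([] ∷ m)      = refl
0<first ((_ ∷ _) ∷ m) = refl

-- The bound 0 cannot be lowered, but it admits every entry; below the top row the bound is positive
-- and `κ-suc-[]` applies.
κ-0-[] : (J : Sentence n) (m : WSent n) → κ 0 J ([] ∷ m) ≡ κ 0 J m
κ-0-[] []      m = refl
κ-0-[] (v ∷ J) m = trans
  (𝓕-[] m (λ m₁ m₂ → δᵂ (concat m₂) (toList v) * (ι (0 <ᵇ first m₂) * κ (first m₂) J m₁)))
  (𝓕-cong m (λ m₁ m₂ → cong (δᵂ (concat m₂) (toList v) *_)
    (cong₂ _*_ (cong ι (sym (0<first m₂))) (κ-suc-[] (first m₂) J m₁))))

-- A row containing 1 starts with 1, which a positive bound forbids.
κ-suc-∷ : (b : ℕ) (J : Sentence n) (a : Col n) (w : Word n) (m : WSent n) → κ (suc b) J ((a ∷ w) ∷ m) ≡ 0ℤ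
κ-suc-∷ b []      a w m = refl
κ-suc-∷ b (v ∷ J) a w m = trans
  (𝓕-∷ (a ∷ w) m (λ m₁ m₂ → δᵂ (concat m₂) (toList v) * (ι (suc b <ᵇ first m₂) * κ (first m₂) J m₁)))
  (trans (σ-cong-++ (a ∷ w) (λ p q eq → trans (𝓕-cong m (vanish p q eq)) (∑-zero (factorizations m))))
    (σ-vanish (a ∷ w) (λ _ _ → refl)))
  where
  vanish : ∀ p q → p ++ q ≡ a ∷ w → ∀ m₁ m₂ →
    δᵂ (concat (q ∷ m₂)) (toList v) * (ι (suc b <ᵇ first (q ∷ m₂)) * κ (first (q ∷ m₂)) J (p ∷ m₁)) ≡ 0ℤ
  -- A letter of the first word in this row makes its leading entry 1, not above `suc b`.
  vanish p       (c ∷ q) eq m₁ m₂ = *-zeroʳ (δᵂ (concat ((c ∷ q) ∷ m₂)) (toList v))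
  -- Otherwise the whole word lies in lower rows, where the bound is positive again.
  vanish (c ∷ p) []      eq m₁ m₂ = trans
    (cong (λ i → δᵂ (concat m₂) (toList v) * (ι (b <ᵇ first m₂) * i)) (κ-suc-∷ (first m₂) J c p m₁))
    (trans (cong (δᵂ (concat m₂) (toList v) *_) (*-zeroʳ (ι (b <ᵇ first m₂)))) (*-zeroʳ (δᵂ (concat m₂) (toList v))))

-- All entries 1 lie in the first row, since the first column increases strictly.
κ-0-∷ : (v : NWord n) (J : Sentence n) (w : NWord n) (m : WSent n) →
  κ 0 (v ∷ J) (toList w ∷ m) ≡ 𝓕 m (λ m₁ m₂ → δᵂ (toList w ++ concat m₂) (toList v) * κ 0 J m₁)
κ-0-∷ v J w⁺@(a ∷ w) m = begin
  κ 0 (v ∷ J) ((a ∷ w) ∷ m)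
    ≡⟨ 𝓕-∷ (a ∷ w) m (λ m₁ m₂ → δᵂ (concat m₂) (toList v) * (ι (0 <ᵇ first m₂) * κ (first m₂) J m₁)) ⟩
  σ (a ∷ w) (λ p q → 𝓕 m (λ m₁ m₂ → δᵂ (q ++ concat m₂) (toList v) * (ι (0 <ᵇ first (q ∷ m₂)) * κ (first (q ∷ m₂)) J (p ∷ m₁))))
    ≡⟨ σ-cong-++ (a ∷ w) (λ p q eq → trans (𝓕-cong m (λ m₁ m₂ → simplify p q eq m₁ m₂))
         (𝓕-*ˡ m (𝟘 p) (λ m₁ m₂ → δᵂ (q ++ concat m₂) (toList v) * κ 0 J m₁))) ⟩
  σ (a ∷ w) (λ p q → 𝟘 p * 𝓕 m (λ m₁ m₂ → δᵂ (q ++ concat m₂) (toList v) * κ 0 J m₁))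
    ≡⟨ σ-𝟘ˡ (a ∷ w) (λ q → 𝓕 m (λ m₁ m₂ → δᵂ (q ++ concat m₂) (toList v) * κ 0 J m₁)) ⟩
  𝓕 m (λ m₁ m₂ → δᵂ (a ∷ w ++ concat m₂) (toList v) * κ 0 J m₁)  ∎
  where
  first-suc : ∀ q m₂ → ∃[ k ] first (q ∷ m₂) ≡ suc k
  first-suc []      m₂ = first m₂ , refl
  first-suc (_ ∷ _) m₂ = 0 , refl
  simplify : ∀ p q → p ++ q ≡ a ∷ w → ∀ m₁ m₂ →
    δᵂ (q ++ concat m₂) (toList v) * (ι (0 <ᵇ first (q ∷ m₂)) * κ (first (q ∷ m₂)) J (p ∷ m₁)) ≡
    𝟘 p * (δᵂ (q ++ concat m₂) (toList v) * κ 0 J m₁)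
  -- The top row starts with 1 and no 1 is left below it; lowering the entries turns the bound 1
  -- back into 0.
  simplify []      (c ∷ q) eq m₁ m₂ = trans
    (cong (δᵂ (c ∷ q ++ concat m₂) (toList v) *_) (trans (*-identityˡ (κ 1 J ([] ∷ m₁))) (κ-suc-[] 0 J m₁)))
    (sym (*-identityˡ (δᵂ (c ∷ q ++ concat m₂) (toList v) * κ 0 J m₁)))
  -- An entry 1 left for the lower rows is excluded by the positive leading entry of the top row.
  simplify (c ∷ p) q eq m₁ m₂ with first (q ∷ m₂) | first-suc q m₂
  ... | .(suc k) | k , refl = trans
    (cong (λ i → δᵂ (q ++ concat m₂) (toList v) * (1ℤ * i)) (κ-suc-∷ k J c p m₁))
    (*-zeroʳ (δᵂ (q ++ concat m₂) (toList v)))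

-- The shapes, with multiplicity, of the immaculate tableaux of type m; the first argument bounds the length of m.
shapes : ℕ → WSent n → List (Sentence n)
shapes k       []            = [] ∷ []
shapes zero    (_ ∷ _)       = []
shapes (suc k) ([] ∷ m)      = shapes k m
shapes (suc k) ((a ∷ w) ∷ m) =
  concatMap (λ (m₁ , m₂) → map ((a ∷ w ++ concat m₂) ∷_) (shapes k m₁)) (factorizations m)

∑-shapes-∷ : (k : ℕ) (a : Col n) (w : Word n) (m : WSent n) (F : Sentence n → ℤ) →
  ∑ (shapes (suc k) ((a ∷ w) ∷ m)) F ≡
  𝓕 m (λ m₁ m₂ → ∑ (shapes k m₁) (λ S → F ((a ∷ w ++ concat m₂) ∷ S)))
∑-shapes-∷ k a w m F = trans
  (∑-concatMap (λ (m₁ , m₂) → map ((a ∷ w ++ concat m₂) ∷_) (shapes k m₁)) (factorizations m) F)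
  (𝓕-cong m (λ m₁ m₂ → ∑-map ((a ∷ w ++ concat m₂) ∷_) (shapes k m₁) F))

-- Both sides obey one recursion: the first nonempty word goes wholly into the top row, followed by
-- a suffix of each later word.
κ-shapes : (k : ℕ) (m : WSent n) → length m ≤ k → (J : Sentence n) → κ 0 J m ≡ ∑ (shapes k m) (λ S → δˢ S J)
κ-shapes k       []            le       []      = refl
κ-shapes k       []            le       (v ∷ J) = refl
κ-shapes (suc k) ([] ∷ m)      (s≤s le) J       = trans (κ-0-[] J m) (κ-shapes k m le J)
κ-shapes (suc k) ((a ∷ w) ∷ m) (s≤s le) []      = sym (trans (∑-shapes-∷ k a w m (λ S → δˢ S []))
  (∑-vanish (factorizations m) (λ (m₁ , m₂) → ∑-zero (shapes k m₁))))
κ-shapes (suc k) ((a ∷ w) ∷ m) (s≤s le) (v ∷ J) = trans (κ-0-∷ v J (a ∷ w) m) (sym (begin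
  ∑ (shapes (suc k) ((a ∷ w) ∷ m)) (λ S → δˢ S (v ∷ J))
    ≡⟨ ∑-shapes-∷ k a w m (λ S → δˢ S (v ∷ J)) ⟩
  𝓕 m (λ m₁ m₂ → ∑ (shapes k m₁) (λ S → δˢ ((a ∷ w ++ concat m₂) ∷ S) (v ∷ J)))
    ≡⟨ 𝓕-cong-Factors m (λ m₁ m₂ fs → trans
         (∑-cong (shapes k m₁) (λ S → δᵂˢ-∷ (a ∷ w ++ concat m₂) (toW S) (toList v) (toW J)))
         (trans (∑-*ˡ (shapes k m₁) (δᵂ (a ∷ w ++ concat m₂) (toList v)) (λ S → δˢ S J))
           (cong (δᵂ (a ∷ w ++ concat m₂) (toList v) *_)
             (sym (κ-shapes k m₁ (subst (_≤ k) (sym (Factors.length₁ fs)) le) J))))) ⟩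
  𝓕 m (λ m₁ m₂ → δᵂ (a ∷ w ++ concat m₂) (toList v) * κ 0 J m₁)  ∎))

-- `H-expansion` has the recursion of `shapes`, so the list that counts tableaux also expands `H`.
H-shapes : (k : ℕ) (m : WSent n) → length m ≤ k → (K : Sentence n) →
  H (dropEmpty m) K ≡ ∑ (shapes k m) (λ S → 𝔖 S K)
H-shapes k       []            le       K = sym (+-identityʳ (one K))
H-shapes (suc k) ([] ∷ m)      (s≤s le) K = H-shapes k m le K
H-shapes (suc k) ((a ∷ w) ∷ m) (s≤s le) K = begin
  H ((a ∷ w) ∷ dropEmpty m) K
    ≡⟨ H-expansion (a ∷ w) m K ⟩
  𝓕 m (λ m₁ m₂ → 𝔹 (a ∷ w ++ concat m₂) (H (dropEmpty m₁)) K)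
    ≡⟨ 𝓕-cong-Factors m (λ m₁ m₂ fs →
         𝔹-∑ (shapes k m₁) 𝔖 (H-shapes k m₁ (subst (_≤ k) (sym (Factors.length₁ fs)) le)) (a ∷ w ++ concat m₂) K) ⟩
  𝓕 m (λ m₁ m₂ → ∑ (shapes k m₁) (λ S → 𝔖 ((a ∷ w ++ concat m₂) ∷ S) K))
    ≡⟨ ∑-shapes-∷ k a w m (λ S → 𝔖 S K) ⟨
  ∑ (shapes (suc k) ((a ∷ w) ∷ m)) (λ S → 𝔖 S K)  ∎

shapes-size : (k : ℕ) (m : WSent n) → All (λ S → size S ≡ length (concat m)) (shapes k m)
shapes-size k       []            = refl ∷ []
shapes-size zero    (_ ∷ _)       = []
shapes-size (suc k) ([] ∷ m)      = shapes-size k m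
shapes-size (suc k) ((a ∷ w) ∷ m) = concat⁺ (map⁺ (All.map
  (λ {(m₁ , m₂)} fs → map⁺ (All.map (λ {S} eq → cong suc (begin
    length (w ++ concat m₂) ℕ+ size S
      ≡⟨ cong₂ _ℕ+_ (length-++ w) eq ⟩
    (length w ℕ+ length (concat m₂)) ℕ+ length (concat m₁)
      ≡⟨ ℕₚ.+-assoc (length w) (length (concat m₂)) (length (concat m₁)) ⟩
    length w ℕ+ (length (concat m₂) ℕ+ length (concat m₁))
      ≡⟨ cong (length w ℕ+_) (trans (ℕₚ.+-comm (length (concat m₂)) (length (concat m₁))) (Factors.letters fs)) ⟩
    length w ℕ+ length (concat m)
      ≡⟨ length-++ w ⟨
    length (w ++ concat m)  ∎)) (shapes-size k m₁)))
  (factorizations-Factors m)))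

open import Data.Integer using (+_)

theorem5p12 : (n : ℕ) (C K : Sentence n) →
    H C K ≡ sumℤ (map (λ J → (+ Kostka J C) * 𝔖 J K) (sentencesOfSize n (size C)))
theorem5p12 n C K = sym (begin
  ∑ Js (λ J → (+ Kostka J C) * 𝔖 J K)
    ≡⟨ ∑-cong Js (λ J → trans
         (cong (_* 𝔖 J K) (trans (Kostka-κ J C) (κ-shapes (length m) m ℕₚ.≤-refl J)))
         (sym (∑-*ʳ Ss (λ S → δˢ S J) (𝔖 J K)))) ⟩
  ∑ Js (λ J → ∑ Ss (λ S → δˢ S J * 𝔖 J K))
    ≡⟨ ∑-swap Js Ss (λ J S → δˢ S J * 𝔖 J K) ⟩
  ∑ Ss (λ S → ∑ Js (λ J → δˢ S J * 𝔖 J K))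
    -- Each `S` in `Ss` has the size of `C` and so meets exactly one `J`; the multiplicities in `Ss`
    -- are the Kostka numbers.
    ≡⟨ ∑-cong-All (shapes-size (length m) m) (λ S eq → begin
      ∑ Js (λ J → δˢ S J * 𝔖 J K)
        ≡⟨ ∑-cong Js (λ J → cong (_* 𝔖 J K) (δᵂˢ-sym (toW S) (toW J))) ⟩
      ∑ Js (λ J → δˢ J S * 𝔖 J K)
        ≡⟨ ∑-sentencesOfSize-δ (size C) S (λ J → 𝔖 J K) ⟩
      𝟙 (size S ≟ℕ size C) * 𝔖 S K
        ≡⟨ cong (_* 𝔖 S K) (𝟙-yes (size S ≟ℕ size C) (trans eq (sym (size-flat C)))) ⟩
      1ℤ * 𝔖 S K
        ≡⟨ *-identityˡ (𝔖 S K) ⟩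
      𝔖 S K  ∎) ⟩
  ∑ Ss (λ S → 𝔖 S K)
    ≡⟨ H-shapes (length m) m ℕₚ.≤-refl K ⟨
  H (dropEmpty m) K
    ≡⟨ cong (λ I → H I K) (dropEmpty-toW C) ⟩
  H C K  ∎)
  where
  m  = toW C
  Js = sentencesOfSize n (size C)
  Ss = shapes (length m) m
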